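{- For the Set Packing problem, for any $\delta>0$ there exist $\varepsilon>0$ and a polynomial-time randomized algorithm which, given as input a collection $\mathcal S$ of $n$ sets over a universe $U$ and the guarantee that there exist $m$ sets in $\mathcal S$ that form a partition of $U$, finds $m'=(1-\delta)\cdot m$ many sets $S_1,\ldots,S_{m'}$ in $\mathcal S$ together with their subsets $A_1\subseteq S_1,\ldots,A_{m'}\subseteq S_{m'}$, such that for every $i\in[m']$, $|A_i|\ge \varepsilon\cdot|S_i|$, and the sets $A_1,\ldots,A_{m'}$ are disjoint.
   Context: Set Packing: the input is a finite collection $\mathcal S$ of subsets of a finite universe $U$. The notation $[m']$ denotes $\{1,\ldots,m'\}$, and "the sets $A_1,\ldots,A_{m'}$ are disjoint" means pairwise disjoint. The sets $S_1,\ldots,S_{m'}$ are distinct members of the collection $\mathcal S$. -}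

module Defs where

open import Data.Bool.Base using (Bool; true; false)
open import Data.Fin.Base using (Fin; zero)
open import Data.Fin.Subset using (Subset; ∣_∣; _∩_; _⊆_; Nonempty; Empty) renaming (_∈_ to _∈ₛ_)
open import Data.Integer.Base using (+_)
open import Data.List.Base using (List; []; _∷_; length; allFin)
open import Data.List.Membership.Propositional using (_∈_)
open import Data.List.Relation.Unary.All using (All)
open import Data.List.Relation.Unary.Unique.Propositional using (Unique)
open import Data.Nat.Base using (ℕ; zero; suc; _+_; _*_; _^_; _≤_)
open import Data.Product.Base using (Σ; ∃; _×_; _,_)
open import Data.Rational.Base as ℚ using (ℚ; 1ℚ)
open import Data.Vec.Base as Vec using (Vec; lookup; replicate; _[_]≔_)
open import Relation.Binary.PropositionalEquality using (_≡_; _≢_)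

------------------------------------------------------------------------
-- Model of computation: N. D. Jones's WHILE language over binary trees
-- ("Computability and Complexity", MIT Press 1997), with a coin-flip
-- command added. An elementary operation costs one time unit. Trees are
-- immutable, so an implementation shares subtrees by pointers, and the
-- polynomial-time programs are those of Turing machines. For the same
-- reason tests only look at the root of a tree, and there is no equality
-- test on whole trees.

infixr 5 _∙_

data Tree : Set where
  nil : Tree
  _∙_ : Tree → Tree → Tree

size : Tree → ℕ
size nil     = 1
size (l ∙ r) = suc (size l + size r)

head tail : Tree → Tree
head nil     = nil
head (l ∙ _) = l
tail nil     = nil
tail (_ ∙ r) = r

data Expr (v : ℕ) : Set where
  var   : Fin v → Expr v
  nil   : Expr v
  cons  : Expr v → Expr v → Expr v
  hd tl : Expr v → Expr v

infix  6 _≔_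
infixr 5 _⨾_

data Cmd (v : ℕ) : Set where
  _≔_           : Fin v → Expr v → Cmd v
  flip          : Fin v → Cmd v
  _⨾_           : Cmd v → Cmd v → Cmd v
  if_then_else_ : Expr v → Cmd v → Cmd v → Cmd v
  while_loop_   : Expr v → Cmd v → Cmd v

Store : ℕ → Set
Store v = Vec Tree v

⟦_⟧ : ∀ {v} → Expr v → Store v → Tree
⟦ var x    ⟧ σ = lookup σ x
⟦ nil      ⟧ σ = nil
⟦ cons d e ⟧ σ = ⟦ d ⟧ σ ∙ ⟦ e ⟧ σ
⟦ hd e     ⟧ σ = head (⟦ e ⟧ σ)
⟦ tl e     ⟧ σ = tail (⟦ e ⟧ σ)

cost : ∀ {v} → Expr v → ℕ
cost (var _)    = 1
cost nil        = 1
cost (cons d e) = suc (cost d + cost e)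
cost (hd e)     = suc (cost e)
cost (tl e)     = suc (cost e)

encodeBool : Bool → Tree
encodeBool false = nil
encodeBool true  = nil ∙ nil

-- ⟨ c , σ , ω ⟩⇓[ t ]⟨ σ′ , ω′ ⟩ : started in store σ with random bits ω
-- still to be read, c halts after exactly t time units in store σ′ with
-- ω′ unread. A flip with no bits left is stuck. In tests, nil is false
-- and every other tree is true.

data ⟨_,_,_⟩⇓[_]⟨_,_⟩ {v : ℕ} :
     Cmd v → Store v → List Bool → ℕ → Store v → List Bool → Set where

  assign : ∀ {x e σ ω} →
    ⟨ x ≔ e , σ , ω ⟩⇓[ suc (cost e) ]⟨ σ [ x ]≔ ⟦ e ⟧ σ , ω ⟩

  toss : ∀ {x b σ ω} →
    ⟨ flip x , σ , b ∷ ω ⟩⇓[ 1 ]⟨ σ [ x ]≔ encodeBool b , ω ⟩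

  seq : ∀ {c d σ σ′ σ″ ω ω′ ω″ s t} →
    ⟨ c , σ , ω ⟩⇓[ s ]⟨ σ′ , ω′ ⟩ →
    ⟨ d , σ′ , ω′ ⟩⇓[ t ]⟨ σ″ , ω″ ⟩ →
    ⟨ c ⨾ d , σ , ω ⟩⇓[ s + t ]⟨ σ″ , ω″ ⟩

  if-true : ∀ {e c d σ σ′ ω ω′ t} →
    ⟦ e ⟧ σ ≢ nil →
    ⟨ c , σ , ω ⟩⇓[ t ]⟨ σ′ , ω′ ⟩ →
    ⟨ if e then c else d , σ , ω ⟩⇓[ suc (cost e + t) ]⟨ σ′ , ω′ ⟩

  if-false : ∀ {e c d σ σ′ ω ω′ t} →
    ⟦ e ⟧ σ ≡ nil →
    ⟨ d , σ , ω ⟩⇓[ t ]⟨ σ′ , ω′ ⟩ →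
    ⟨ if e then c else d , σ , ω ⟩⇓[ suc (cost e + t) ]⟨ σ′ , ω′ ⟩

  while-true : ∀ {e c σ σ′ σ″ ω ω′ ω″ s t} →
    ⟦ e ⟧ σ ≢ nil →
    ⟨ c , σ , ω ⟩⇓[ s ]⟨ σ′ , ω′ ⟩ →
    ⟨ while e loop c , σ′ , ω′ ⟩⇓[ t ]⟨ σ″ , ω″ ⟩ →
    ⟨ while e loop c , σ , ω ⟩⇓[ suc (cost e + (s + t)) ]⟨ σ″ , ω″ ⟩

  while-false : ∀ {e c σ ω} →
    ⟦ e ⟧ σ ≡ nil →
    ⟨ while e loop c , σ , ω ⟩⇓[ suc (cost e) ]⟨ σ , ω ⟩

-- Variable 0 holds the input at the start and the output at the end; all
-- other variables start as nil.

record Program : Set where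
  field
    extraVars : ℕ
    body      : Cmd (suc extraVars)

Runs : Program → Tree → List Bool → ℕ → Tree → Set
Runs A input ω t output =
  ∃ λ σ → ∃ λ ω′ →
    ⟨ body , input Vec.∷ replicate extraVars nil , ω ⟩⇓[ t ]⟨ σ , ω′ ⟩ ×
    lookup σ zero ≡ output
  where open Program A

-- Under a uniformly random ω ∈ {0,1}^T, the event E has probability ≥ 2/3.

ProbAtLeast⅔ : (T : ℕ) → (Vec Bool T → Set) → Set
ProbAtLeast⅔ T E =
  Σ (List (Vec Bool T)) λ good →
    Unique good × All E good × 2 * 2 ^ T ≤ 3 * length good

-- A solves, in randomized polynomial time, the search problem of finding,
-- on inputs satisfying Promise, a tree satisfying Correct. The time bound
-- c·sizeᵏ holds for all inputs and all random bits; since a flip costs one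
-- time unit, this is also a bound on the number of random bits needed.

record SolvesInRandomizedPolyTime
         (A : Program) {I : Set} (encode : I → Tree)
         (Promise : I → Set) (Correct : I → Tree → Set) : Set where
  field
    c k : ℕ

  bound : I → ℕ
  bound x = c * size (encode x) ^ k

  field
    halts : ∀ x (ω : Vec Bool (bound x)) →
      ∃ λ t → ∃ λ y → Runs A (encode x) (Vec.toList ω) t y × t ≤ bound x
    succeeds : ∀ x → Promise x →
      ProbAtLeast⅔ (bound x) λ ω →
        ∃ λ t → ∃ λ y → Runs A (encode x) (Vec.toList ω) t y × Correct x y

------------------------------------------------------------------------
-- Encodings

encodeℕ : ℕ → Tree
encodeℕ zero    = nil
encodeℕ (suc n) = nil ∙ encodeℕ n

encodeList : {X : Set} → (X → Tree) → List X → Tree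
encodeList f []       = nil
encodeList f (x ∷ xs) = f x ∙ encodeList f xs

encodeSubset : ∀ {u} → Subset u → Tree
encodeSubset A = encodeList encodeBool (Vec.toList A)

------------------------------------------------------------------------
-- Set Packing

-- The universe U is Fin u. The number m belongs to the input as part of
-- the guarantee that some m of the sets partition U.

record Instance : Set where
  field
    u        : ℕ
    𝒮        : List (Subset u)
    distinct : Unique 𝒮
    m        : ℕ

encodeInstance : Instance → Tree
encodeInstance I = encodeℕ u ∙ encodeList encodeSubset 𝒮 ∙ encodeℕ m
  where open Instance I

PairwiseDisjoint : ∀ {u k} → (Fin k → Subset u) → Set
PairwiseDisjoint A = ∀ i j → i ≢ j → Empty (A i ∩ A j)

record IsPartition {u k : ℕ} (P : Fin k → Subset u) : Set where
  field
    nonempty : ∀ i → Nonempty (P i)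
    disjoint : PairwiseDisjoint P
    covers   : ∀ x → ∃ λ i → x ∈ₛ P i

HasPartition : Instance → Set
HasPartition I =
  Σ (Fin m → Subset u) λ P → (∀ i → P i ∈ 𝒮) × IsPartition P
  where open Instance I

fromℕ : ℕ → ℚ
fromℕ n = + n ℚ./ 1

IsLeastℕ≥ : ℚ → ℕ → Set
IsLeastℕ≥ q n = q ℚ.≤ fromℕ n × (∀ k → q ℚ.≤ fromℕ k → n ≤ k)

-- As (1-δ)·m need not be a natural number, m′ is that number rounded up
-- (so m′ = 0 if δ ≥ 1).

record PartialPacking (δ ε : ℚ) (I : Instance) : Set where
  open Instance I
  field
    m′         : ℕ
    m′-def     : IsLeastℕ≥ ((1ℚ ℚ.- δ) ℚ.* fromℕ m) m′
    S A        : Fin m′ → Subset u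
    S∈𝒮        : ∀ i → S i ∈ 𝒮
    S-distinct : ∀ i j → i ≢ j → S i ≢ S j
    A⊆S        : ∀ i → A i ⊆ S i
    A-large    : ∀ i → ε ℚ.* fromℕ ∣ S i ∣ ℚ.≤ fromℕ ∣ A i ∣
    A-disjoint : PairwiseDisjoint A

encodePacking : ∀ {δ ε I} → PartialPacking δ ε I → Tree
encodePacking p =
  encodeList (λ i → encodeSubset (S i) ∙ encodeSubset (A i)) (allFin m′)
  where open PartialPacking p

IsPartialPacking : ℚ → ℚ → (I : Instance) → Tree → Set
IsPartialPacking δ ε I y = Σ (PartialPacking δ ε I) λ p → y ≡ encodePacking p

{-# OPTIONS --safe #-}

-- With δ = p/d put L = 2d, q = L + 1 and ε = 1/q. A set S of fewer than q
-- elements needs only one element, so the small sets are served by an auction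
-- for bipartite matching: a set without an element takes a cheapest one of its
-- own, raises the price by 1 and evicts the previous owner, and gives up when
-- all its elements cost L. By linear programming duality the number k₁ of
-- small sets served is at least L/(L + 1) times the number of small sets in the
-- hidden partition. The other sets are then treated greedily by increasing
-- size, S receiving ⌈|S|/q⌉ ≤ 2|S|/q of its free elements if it has that many.
-- If g sets of the partition are blocked while k₂ sets are served then, since
-- a blocked set P lost L/q of its elements to sets not larger than P, a summation
-- by parts over the sizes gives L g ≤ k₁ + 2 k₂. Hence d m ≤ (d + 1)(k₁ + k₂),
-- which is enough for ⌈(1 - δ) m⌉ sets. No coin flips are needed.

module Submission where

open import Data.Bool.Base using (Bool; true; false; not) renaming (if_then_else_ to choose)
import Data.Bool.Properties as Bool
open import Data.Empty using (⊥; ⊥-elim)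
open import Data.Fin.Base using (Fin; zero; suc)
import Data.Fin.Properties as Fin
open import Data.Fin.Subset using (Subset; _∈_; _∉_; _⊆_; ∣_∣; ⁅_⁆; _∩_; _─_; Nonempty) renaming (⊥ to ∅)
open import Data.Fin.Subset.Properties using
  (x∈⁅x⁆; x∈⁅y⁆⇒x≡y; ∣⁅x⁆∣≡1; x∈p⇒∣p-x∣<∣p∣; p⊆q⇒∣p∣≤∣q∣; x∈p∩q⁻; x∈p∩q⁺; x∈p∧x∉q⇒x∈p─q; ∣p∣≤n)
open import Data.Integer.Base as ℤ using (ℤ; +[1+_]) renaming (+_ to pos)
import Data.Integer.Properties as ℤ
import Data.Integer.Tactic.RingSolver as ℤ
open import Data.List.Base as List using (List; []; _∷_; length; map; _++_; filter; allFin)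
open import Data.List.Properties using
  (length-map; length-++; length-tabulate; length-filter; filter-accept; filter-reject; map-tabulate; tabulate-lookup)
import Data.List.Membership.Propositional as List
open import Data.List.Membership.Propositional.Properties using
  (∈-lookup; ∈-map⁺; ∈-map⁻; ∈-++⁺ˡ; ∈-++⁺ʳ; ∈-++⁻; ∈-∃++; ∈-filter⁺; ∈-filter⁻)
open import Data.List.Relation.Unary.All as All using (All; []; _∷_)
open import Data.List.Relation.Unary.All.Properties using (all-filter)
open import Data.List.Relation.Unary.AllPairs using (AllPairs; []; _∷_)
open import Data.List.Relation.Unary.Any using (here; there)
open import Data.List.Relation.Unary.Unique.Propositional using (Unique)
import Data.List.Relation.Unary.Unique.Propositional.Properties as Unique
open import Data.Nat.Base using (ℕ; zero; suc; pred; _+_; _*_; _∸_; _^_; _≤_; _<_; z≤n; s≤s)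
open import Data.Nat.Coprimality using (Coprime)
open import Data.Nat.ListAction using (sum)
open import Data.Nat.Properties
open import Data.Nat.Tactic.RingSolver using (solve-∀)
open import Data.Product.Base using (Σ; ∃; ∃₂; _×_; _,_; proj₁; proj₂)
open import Data.Rational.Base as ℚ using (ℚ; mkℚ; 0ℚ; 1ℚ)
import Data.Rational.Properties as ℚ
open import Data.Rational.Unnormalised.Base as ℚᵘ using (ℚᵘ; mkℚᵘ; 1ℚᵘ)
import Data.Rational.Unnormalised.Properties as ℚᵘ
open import Data.Sum.Base as Sum using (_⊎_; inj₁; inj₂; [_,_]′)
open import Data.Unit.Base using (⊤; tt)
open import Data.Vec.Base as Vec using (Vec; []; _∷_; lookup; here; there; _[_]≔_)
open import Data.Vec.Properties using
  (toList∘fromList; ∷-injectiveʳ; lookup∘update; lookup∘update′; lookup-replicate; []=⇒lookup; ≡-dec)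
open import Function.Base using (_∘_; case_of_)
open import Relation.Binary.PropositionalEquality
open import Relation.Nullary using (yes; no; does; Dec; ¬?; ¬_; contradiction)
open import Defs

-- The split at q comes from rounding: a set S gets ⌈|S|/q⌉ elements, and the bound q |M| < |S| + q
-- on its share M becomes 2 |S| only if |S| ≥ q. Smaller sets ask for one element each, which is a
-- matching problem; capping the prices at the constant L keeps the auction within n + uL bids.
--
-- In the greedy phase losses are naturally measured in elements, whereas sets have to be counted:
-- one large served set has the weight of many smaller blocked ones. The order by size excludes
-- this, because the weight inequality then holds at every size separately.
--
-- The theorem also asks for an explicit WHILE program with a time bound on all inputs. So the
-- algorithm is given twice: as plain functions, about which correctness is proved, and in typed
-- combinators that carry code, meaning and a time bound in terms of u, n and m. Their loops run
-- along vectors of known length, and numbers are only shifted by constants and tested for zero,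
-- which explains the counting down in place of comparisons.

private variable
  n w : ℕ

-- A functional language compiled to WHILE programs

infixr 9 _∘F_

data Fun : Set where
  idF nilF hdF tlF : Fun
  _∘F_ pairF       : Fun → Fun → Fun
  ifF              : Fun → Fun → Fun → Fun
  loopF            : Fun → Fun

caseTree : {A : Set} → Tree → A → A → A
caseTree nil     a b = b
caseTree (_ ∙ _) a b = a

iterList : (Tree → Tree) → Tree → Tree → Tree → Tree
iterList f e s nil     = s
iterList f e s (a ∙ l) = iterList f e (f (e ∙ s ∙ a)) l

⟦_⟧F : Fun → Tree → Tree
⟦ idF ⟧F x       = x
⟦ nilF ⟧F x      = nil
⟦ hdF ⟧F x       = head x
⟦ tlF ⟧F x       = tail x
⟦ f ∘F g ⟧F x    = ⟦ f ⟧F (⟦ g ⟧F x)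
⟦ pairF f g ⟧F x = ⟦ f ⟧F x ∙ ⟦ g ⟧F x
⟦ ifF c f g ⟧F x = caseTree (⟦ c ⟧F x) (⟦ f ⟧F x) (⟦ g ⟧F x)
⟦ loopF f ⟧F x   = iterList ⟦ f ⟧F (head x) (head (tail x)) (tail (tail x))

iterTime : (Tree → Tree) → (Tree → ℕ) → Tree → Tree → Tree → ℕ
iterTime f t e s nil     = 4
iterTime f t e s (a ∙ l) =
  suc (3 + ((4 + (12 + (t (e ∙ s ∙ a) + (12 + 3)))) + iterTime f t e (f (e ∙ s ∙ a)) l))

-- The literals are the costs of the glue commands inserted by `compile`, bracketed as the
-- sequencing brackets them, so that `compile-correct` needs no arithmetic.
time : Fun → Tree → ℕ
time idF x         = 2
time nilF x        = 2
time hdF x         = 3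
time tlF x         = 3
time (f ∘F g) x    = time g x + time f (⟦ g ⟧F x)
time (pairF f g) x = 4 + (time f x + (4 + (4 + (time g x + (5 + 4)))))
time (ifF c f g) x =
  4 + (time c x + suc (1 + caseTree (⟦ c ⟧F x) (3 + (3 + time f x)) (3 + (3 + time g x))))
time (loopF f) x   =
  11 + (iterTime ⟦ f ⟧F (time f) (head x) (head (tail x)) (tail (tail x)) + 4)

-- Variable 0 carries the argument and the result, variable 1 is a stack.
X K : Expr 2
X = var zero
K = var (suc zero)

setX setK : Expr 2 → Cmd 2
setX e = zero ≔ e
setK e = suc zero ≔ e

loopCmd : Cmd 2 → Cmd 2
loopCmd c = while tl (tl X) loop
  (setK (cons X K) ⨾
   setX (cons (hd X) (cons (hd (tl X)) (hd (tl (tl X))))) ⨾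
   c ⨾
   setX (cons (hd (hd K)) (cons X (tl (tl (tl (hd K)))))) ⨾
   setK (tl K))

compile : Fun → Cmd 2
compile idF         = setX X
compile nilF        = setX nil
compile hdF         = setX (hd X)
compile tlF         = setX (tl X)
compile (f ∘F g)    = compile g ⨾ compile f
compile (pairF f g) =
  setK (cons X K) ⨾ compile f ⨾ setK (cons X K) ⨾ setX (hd (tl K)) ⨾ compile g ⨾
  setX (cons (hd K) X) ⨾ setK (tl (tl K))
compile (ifF c f g) =
  setK (cons X K) ⨾ compile c ⨾
  (if X then (setX (hd K) ⨾ setK (tl K) ⨾ compile f)
        else (setX (hd K) ⨾ setK (tl K) ⨾ compile g))
compile (loopF f)   =
  -- Rebuilding the argument gives it the shape `e ∙ s ∙ l` even if the tree was too shallow, so the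
  -- loop starts in the form that `go` below expects.
  setX (cons (hd X) (cons (hd (tl X)) (tl (tl X)))) ⨾ loopCmd (compile f) ⨾ setX (hd (tl X))

-- The stack `k` is arbitrary and comes back intact; this lets the induction hypothesis apply while
-- saved values lie on the stack.
compile-correct : ∀ f x k ω →
  ⟨ compile f , x Vec.∷ k Vec.∷ Vec.[] , ω ⟩⇓[ time f x ]⟨ ⟦ f ⟧F x Vec.∷ k Vec.∷ Vec.[] , ω ⟩
compile-correct idF x k ω         = assign
compile-correct nilF x k ω        = assign
compile-correct hdF x k ω         = assign
compile-correct tlF x k ω         = assign
compile-correct (f ∘F g) x k ω    =
  seq (compile-correct g x k ω) (compile-correct f (⟦ g ⟧F x) k ω)
compile-correct (pairF f g) x k ω =
  seq assign (seq (compile-correct f x _ ω) (seq assign (seq assign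
    (seq (compile-correct g x _ ω) (seq assign assign)))))
compile-correct (ifF c f g) x k ω =
  seq assign (seq (compile-correct c x _ ω) (branch (⟦ c ⟧F x) refl))
  where
  branch : ∀ y → ⟦ c ⟧F x ≡ y →
    ⟨ if X then (setX (hd K) ⨾ setK (tl K) ⨾ compile f)
           else (setX (hd K) ⨾ setK (tl K) ⨾ compile g) ,
      y Vec.∷ (x ∙ k) Vec.∷ Vec.[] , ω ⟩⇓[
      suc (1 + caseTree y (3 + (3 + time f x)) (3 + (3 + time g x))) ]⟨
      caseTree y (⟦ f ⟧F x) (⟦ g ⟧F x) Vec.∷ k Vec.∷ Vec.[] , ω ⟩
  branch nil     _ = if-false refl (seq assign (seq assign (compile-correct g x k ω)))
  branch (_ ∙ _) _ = if-true (λ ()) (seq assign (seq assign (compile-correct f x k ω)))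
compile-correct (loopF f) x k ω   =
  seq assign (seq (go (head x) (head (tail x)) (tail (tail x))) assign)
  where
  go : ∀ e s l →
    ⟨ loopCmd (compile f) , (e ∙ s ∙ l) Vec.∷ k Vec.∷ Vec.[] , ω ⟩⇓[
      iterTime ⟦ f ⟧F (time f) e s l ]⟨
      (e ∙ iterList ⟦ f ⟧F e s l ∙ nil) Vec.∷ k Vec.∷ Vec.[] , ω ⟩
  go e s nil     = while-false refl
  go e s (a ∙ l) = while-true (λ ())
    (seq assign (seq assign (seq (compile-correct f _ _ ω) (seq assign assign))))
    (go e (⟦ f ⟧F (e ∙ s ∙ a)) l)

-- Typed polynomial-time functions

data Dim : Set where
  #U #N #M : Dim

Dims : Set
Dims = Dim → ℕ

-- The successor keeps the base positive, so that `poly-+` can raise both exponents to a common one.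
scale : Dims → ℕ
scale D = suc (D #U + D #N + D #M)

Poly : (Dims → ℕ) → Set
Poly T = ∃₂ λ c k → ∀ D → T D ≤ c * scale D ^ k

poly-const : ∀ n → Poly (λ _ → n)
poly-const n = n , 0 , λ _ → ≤-reflexive (sym (*-identityʳ n))

poly-dim : ∀ i → Poly (λ D → D i)
poly-dim i = 1 , 1 , λ D → ≤-trans (below i D) (≤-reflexive (sym (trans (*-identityˡ _) (*-identityʳ _))))
  where
  below : ∀ i D → D i ≤ scale D
  below #U D = m≤n⇒m≤1+n (≤-trans (m≤m+n _ _) (m≤m+n _ (D #M)))
  below #N D = m≤n⇒m≤1+n (≤-trans (m≤n+m _ _) (m≤m+n _ (D #M)))
  below #M D = m≤n⇒m≤1+n (m≤n+m _ _)

poly-+ : ∀ {S T} → Poly S → Poly T → Poly (λ D → S D + T D)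
poly-+ {S} {T} (c , j , p) (d , k , q) = c + d , j + k , λ D → begin
  S D + T D
    ≤⟨ +-mono-≤ (p D) (q D) ⟩
  c * scale D ^ j + d * scale D ^ k
    ≤⟨ +-mono-≤ (*-monoʳ-≤ c (^-monoʳ-≤ (scale D) (m≤m+n j k)))
                (*-monoʳ-≤ d (^-monoʳ-≤ (scale D) (m≤n+m k j))) ⟩
  c * scale D ^ (j + k) + d * scale D ^ (j + k)
    ≡⟨ *-distribʳ-+ (scale D ^ (j + k)) c d ⟨
  (c + d) * scale D ^ (j + k) ∎
  where open ≤-Reasoning

poly-* : ∀ {S T} → Poly S → Poly T → Poly (λ D → S D * T D)
poly-* {S} {T} (c , j , p) (d , k , q) = c * d , j + k , λ D → begin
  S D * T D
    ≤⟨ *-mono-≤ (p D) (q D) ⟩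
  c * scale D ^ j * (d * scale D ^ k)
    ≡⟨ [m*n]*[o*p]≡[m*o]*[n*p] c (scale D ^ j) d (scale D ^ k) ⟩
  c * d * (scale D ^ j * scale D ^ k)
    ≡⟨ cong (c * d *_) (^-distribˡ-+-* (scale D) j k) ⟨
  c * d * scale D ^ (j + k) ∎
  where open ≤-Reasoning

-- Types and terms with a time bound

infixr 5 _⊗_

-- Only a `vec` is ever iterated over: its length is a dimension, so the number of rounds is visible
-- in the type. A `list` has no known length and is only extended or split at its head.
data Ty : Set where
  unit bool nat : Ty
  _⊗_  : Ty → Ty → Ty
  list : Ty → Ty
  vec  : Dim → Ty → Ty

El : Ty → Dims → Set
El unit D      = ⊤
El bool D      = Bool
El nat D       = ℕ
El (A ⊗ B) D   = El A D × El B D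
El (list A) D  = List (El A D)
El (vec i A) D = Vec (El A D) (D i)

enc : ∀ A {D} → El A D → Tree
enc unit _        = nil
enc bool b        = encodeBool b
enc nat n         = encodeℕ n
enc (A ⊗ B) (a , b) = enc A a ∙ enc B b
enc (list A) xs   = encodeList (enc A) xs
enc (vec i A) v   = encodeList (enc A) (Vec.toList v)

-- Only the lengths of the lists that are iterated over matter for the
-- running time, as copying a tree costs one step whatever its size.
record Tm (A B : Ty) : Set where
  field
    fun   : ∀ {D} → El A D → El B D
    raw   : Fun
    sound : ∀ {D} (x : El A D) → ⟦ raw ⟧F (enc A x) ≡ enc B (fun x)
    steps : Dims → ℕ
    poly  : Poly steps
    time≤ : ∀ {D} (x : El A D) → time raw (enc A x) ≤ steps D
open Tm

private variable
  A B C G S : Ty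

idT : Tm A A
idT = record { fun = λ x → x ; raw = idF ; sound = λ _ → refl
             ; poly = poly-const 2 ; time≤ = λ _ → ≤-refl }

infixr 9 _∘T_

_∘T_ : Tm B C → Tm A B → Tm A C
_∘T_ {A = A} f g = record
  { fun   = λ x → f .fun (g .fun x)
  ; raw   = f .raw ∘F g .raw
  ; sound = λ x → trans (cong ⟦ f .raw ⟧F (g .sound x)) (f .sound _)
  ; poly  = poly-+ (g .poly) (f .poly)
  ; time≤ = λ x → +-mono-≤ (g .time≤ x)
      (≤-trans (≤-reflexive (cong (time (f .raw)) (g .sound x))) (f .time≤ _))
  }

pairT : Tm G A → Tm G B → Tm G (A ⊗ B)
pairT f g = record
  { fun   = λ x → f .fun x , g .fun x
  ; raw   = pairF (f .raw) (g .raw)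
  ; sound = λ x → cong₂ _∙_ (f .sound x) (g .sound x)
  ; poly  = poly-+ (poly-const 4) (poly-+ (f .poly) (poly-+ (poly-const 8) (poly-+ (g .poly) (poly-const 9))))
  ; time≤ = λ x → +-monoʳ-≤ 4 (+-mono-≤ (f .time≤ x) (+-monoʳ-≤ 8 (+-monoˡ-≤ 9 (g .time≤ x))))
  }

fstT : Tm (A ⊗ B) A
fstT = record { fun = proj₁ ; raw = hdF ; sound = λ _ → refl
              ; poly = poly-const 3 ; time≤ = λ _ → ≤-refl }

sndT : Tm (A ⊗ B) B
sndT = record { fun = proj₂ ; raw = tlF ; sound = λ _ → refl
              ; poly = poly-const 3 ; time≤ = λ _ → ≤-refl }

private
  caseTree-≤ : ∀ t {a b c d} → a ≤ c → b ≤ d → caseTree t a b ≤ c + d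
  caseTree-≤ nil     _ p = ≤-trans p (m≤n+m _ _)
  caseTree-≤ (_ ∙ _) p _ = ≤-trans p (m≤m+n _ _)

  ifF-time : ∀ c f g x {r s t} →
    time c x ≤ r → time f x ≤ s → time g x ≤ t → time (ifF c f g) x ≤ r + (s + t) + 18
  ifF-time c f g x {r} {s} {t} p q u = begin
    4 + (time c x + (2 + caseTree (⟦ c ⟧F x) (6 + time f x) (6 + time g x)))
      ≤⟨ +-monoʳ-≤ 4 (+-mono-≤ p (+-monoʳ-≤ 2
           (caseTree-≤ (⟦ c ⟧F x) (+-monoʳ-≤ 6 q) (+-monoʳ-≤ 6 u)))) ⟩
    4 + (r + (2 + ((6 + s) + (6 + t))))
      ≡⟨ regroup r s t ⟩
    r + (s + t) + 18 ∎
    where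
    open ≤-Reasoning
    regroup : ∀ r s t → 4 + (r + (2 + ((6 + s) + (6 + t)))) ≡ r + (s + t) + 18
    regroup = solve-∀

ifT : Tm G bool → Tm G A → Tm G A → Tm G A
ifT {G = G} {A = A} c f g = record
  { fun   = λ x → choose (c .fun x) (f .fun x) (g .fun x)
  ; raw   = ifF (c .raw) (f .raw) (g .raw)
  ; sound = λ x → branch x (c .fun x) (c .sound x)
  ; poly  = poly-+ (poly-+ (c .poly) (poly-+ (f .poly) (g .poly))) (poly-const 18)
  ; time≤ = λ x → ifF-time (c .raw) (f .raw) (g .raw) _ (c .time≤ x) (f .time≤ x) (g .time≤ x)
  }
  where
  branch : ∀ {D} (x : El G D) b → ⟦ c .raw ⟧F (enc G x) ≡ encodeBool b →
    ⟦ ifF (c .raw) (f .raw) (g .raw) ⟧F (enc G x) ≡ enc A (choose b (f .fun x) (g .fun x))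
  branch x false e rewrite e = g .sound x
  branch x true  e rewrite e = f .sound x

constT : (raw : Fun) (a : ∀ {D} → El A D) →
         (∀ {D} (x : El G D) → ⟦ raw ⟧F (enc G x) ≡ enc A (a {D})) →
         ∀ t → (∀ {D} (x : El G D) → time raw (enc G x) ≤ t) → Tm G A
constT raw a s t p = record
  { fun = λ _ → a ; raw = raw ; sound = s ; poly = poly-const t ; time≤ = p }

falseT : Tm G bool
falseT = constT nilF false (λ _ → refl) 2 (λ _ → ≤-refl)

trueT : Tm G bool
trueT = constT (pairF nilF nilF) true (λ _ → refl) 25 (λ _ → ≤-refl)

ttT : Tm G unit
ttT = constT nilF tt (λ _ → refl) 2 (λ _ → ≤-refl)

zeroT : Tm G nat
zeroT = constT nilF 0 (λ _ → refl) 2 (λ _ → ≤-refl)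

[]T : Tm G (list A)
[]T = constT nilF [] (λ _ → refl) 2 (λ _ → ≤-refl)

sucT : Tm nat nat
sucT = record { fun = suc ; raw = pairF nilF idF ; sound = λ _ → refl
              ; poly = poly-const 25 ; time≤ = λ _ → ≤-refl }

consT : Tm G A → Tm G (list A) → Tm G (list A)
consT x xs = record { fun = λ γ → x .fun γ ∷ xs .fun γ ; raw = p .raw ; sound = p .sound
                    ; poly = p .poly ; time≤ = p .time≤ }
  where p = pairT x xs

isZero : ℕ → Bool
isZero zero    = true
isZero (suc _) = false

isZeroT : Tm nat bool
isZeroT = record
  { fun   = isZero
  ; raw   = ifF idF nilF (pairF nilF nilF)
  ; sound = λ { zero → refl ; (suc _) → refl }
  ; poly  = poly-const (2 + (2 + 25) + 18)
  ; time≤ = λ x → ifF-time idF nilF (pairF nilF nilF) (encodeℕ x) ≤-refl ≤-refl ≤-refl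
  }

predT : Tm nat nat
predT = record { fun = pred ; raw = tlF ; sound = λ { zero → refl ; (suc _) → refl }
               ; poly = poly-const 3 ; time≤ = λ _ → ≤-refl }

-- Replaces the meaning assembled by the combinators with a readable function; for most uses below
-- the two agree by computation.
withFun : (t : Tm A B) (f : ∀ {D} → El A D → El B D) → (∀ {D} x → t .fun {D} x ≡ f x) → Tm A B
withFun {B = B} t f eq = record
  { fun = f ; raw = t .raw ; sound = λ x → trans (t .sound x) (cong (enc B) (eq x))
  ; poly = t .poly ; time≤ = t .time≤ }

powerT : ℕ → Tm A A → Tm A A
powerT zero    t = idT
powerT (suc k) t = t ∘T powerT k t

minusT : ℕ → Tm nat nat
minusT k = withFun (powerT k predT) (_∸ k) (λ {D} → eq D k)
  where
  eq : ∀ D k n → powerT k predT .fun {D} n ≡ n ∸ k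
  eq D zero    n = refl
  eq D (suc k) n = trans (cong pred (eq D k n)) (pred[m∸n]≡m∸[1+n] n k)

plusT : ℕ → Tm nat nat
plusT k = withFun (powerT k sucT) (k +_) (λ {D} → eq D k)
  where
  eq : ∀ D k n → powerT k sucT .fun {D} n ≡ k + n
  eq D zero    n = refl
  eq D (suc k) n = cong suc (eq D k n)

caseList : {X Y : Set} → List X → Y → (X → List X → Y) → Y
caseList []       y f = y
caseList (x ∷ xs) y f = f x xs

caseListT : Tm G (list A) → Tm G B → Tm (G ⊗ A ⊗ list A) B → Tm G B
caseListT {G} {A} {B} l f g = record
  { fun   = λ γ → caseList (l .fun γ) (f .fun γ) (λ x xs → g .fun (γ , x , xs))
  ; raw   = ifF (l .raw) consRaw (f .raw)
  ; sound = λ γ → branch γ (l .fun γ) (l .sound γ)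
  ; poly  = poly-+ (poly-+ (l .poly)
      (poly-+ (poly-+ (poly-+ (poly-const 23) (l .poly)) (g .poly)) (f .poly))) (poly-const 18)
  ; time≤ = λ γ → timed γ (l .fun γ) (l .sound γ)
  }
  where
  consRaw : Fun
  consRaw = g .raw ∘F pairF idF (l .raw)

  branch : ∀ {D} (γ : El G D) xs → ⟦ l .raw ⟧F (enc G γ) ≡ encodeList (enc A) xs →
    ⟦ ifF (l .raw) consRaw (f .raw) ⟧F (enc G γ) ≡
    enc B (caseList xs (f .fun γ) (λ x xs → g .fun (γ , x , xs)))
  branch γ []       e rewrite e = f .sound γ
  branch γ (x ∷ xs) e rewrite e = g .sound (γ , x , xs)

  timed : ∀ {D} (γ : El G D) xs → ⟦ l .raw ⟧F (enc G γ) ≡ encodeList (enc A) xs →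
    time (ifF (l .raw) consRaw (f .raw)) (enc G γ) ≤
    l .steps D + ((23 + l .steps D + g .steps D) + f .steps D) + 18
  timed {D} γ [] e rewrite e =
    ≤-trans (+-monoʳ-≤ 4 (+-mono-≤ (l .time≤ γ) (+-monoʳ-≤ 8 (f .time≤ γ))))
            (nil≤ (l .steps D) (g .steps D) (f .steps D))
    where
    split : ∀ r s t → r + ((23 + r + s) + t) + 18 ≡ 4 + (r + (8 + t)) + (r + s + 29)
    split = solve-∀
    nil≤ : ∀ r s t → 4 + (r + (8 + t)) ≤ r + ((23 + r + s) + t) + 18
    nil≤ r s t = ≤-trans (m≤m+n _ _) (≤-reflexive (sym (split r s t)))
  timed {D} γ (x ∷ xs) e rewrite e =
    ≤-trans (+-monoʳ-≤ 4 (+-mono-≤ (l .time≤ γ)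
              (+-monoʳ-≤ 8 (+-mono-≤ (+-monoʳ-≤ 14 (+-monoˡ-≤ 9 (l .time≤ γ))) (g .time≤ _)))))
            (cons≤ (l .steps D) (g .steps D) (f .steps D))
    where
    split : ∀ r s t → r + ((23 + r + s) + t) + 18 ≡ 4 + (r + (8 + ((14 + (r + 9)) + s))) + (t + 6)
    split = solve-∀
    cons≤ : ∀ r s t → 4 + (r + (8 + ((14 + (r + 9)) + s))) ≤ r + ((23 + r + s) + t) + 18
    cons≤ r s t = ≤-trans (m≤m+n _ _) (≤-reflexive (sym (split r s t)))

-- Iteration along two vectors

mapAcc : {X Y Z W : Set} → (X → Y → Z → Z × W) → Z → Vec X n → Vec Y n → Z × Vec W n
mapAcc f z [] []             = z , []
mapAcc f z (x ∷ xs) (y ∷ ys) =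
  let z′ , ws = mapAcc f z xs ys
      z″ , w  = f x y z′
  in z″ , w ∷ ws

encVec : ∀ A {D} → Vec (El A D) n → Tree
encVec A v = encodeList (enc A) (Vec.toList v)

-- `mapAcc` works from the last entry to the first, while a compiled loop starts at the head. Hence
-- the inputs are zipped in reverse beforehand; the main loop then conses its outputs in the right
-- order.
zipRevOnto : ∀ A B {D} → Tree → Vec (El A D) n → Vec (El B D) n → Tree
zipRevOnto A B acc [] []             = acc
zipRevOnto A B acc (a ∷ as) (b ∷ bs) = zipRevOnto A B ((enc A a ∙ enc B b) ∙ acc) as bs

zipRevStep : Fun
zipRevStep =
  pairF (pairF (pairF (tlF ∘F tlF) (hdF ∘F tlF ∘F hdF ∘F tlF)) (hdF ∘F hdF ∘F tlF))
        (tlF ∘F tlF ∘F hdF ∘F tlF)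

zipRev-correct : ∀ A B {D} acc (as : Vec (El A D) n) (bs : Vec (El B D) n) →
  iterList ⟦ zipRevStep ⟧F nil (acc ∙ encVec B bs) (encVec A as) ≡ zipRevOnto A B acc as bs ∙ nil
zipRev-correct A B acc [] []             = refl
zipRev-correct A B acc (a ∷ as) (b ∷ bs) = zipRev-correct A B _ as bs

zipRev-time : ∀ A B {D} acc (as : Vec (El A D) n) (bs : Vec (El B D) n) →
  iterTime ⟦ zipRevStep ⟧F (time zipRevStep) nil (acc ∙ encVec B bs) (encVec A as) ≡
  n * (35 + time zipRevStep nil) + 4
zipRev-time A B acc [] []             = refl
zipRev-time A B acc (a ∷ as) (b ∷ bs) = cong (137 +_) (zipRev-time A B _ as bs)

zipRevFun : Fun → Fun → Fun
zipRevFun as bs = hdF ∘F loopF zipRevStep ∘F pairF nilF (pairF (pairF nilF bs) as)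

-- The argument is `γ ∙ (s ∙ ws) ∙ (a ∙ b)` with `ws` the outputs so far. The inner function gets
-- `(γ ∙ (a ∙ b)) ∙ s`, and its output goes in front of `ws`.
mapAccStep : Fun → Fun
mapAccStep f =
  pairF (hdF ∘F hdF) (pairF (tlF ∘F hdF) tlF) ∘F
  pairF (f ∘F pairF (pairF hdF (tlF ∘F tlF)) (hdF ∘F hdF ∘F tlF)) (tlF ∘F hdF ∘F tlF)

mapAccStep-time : ∀ f g s d ab →
  time (mapAccStep f) (g ∙ (s ∙ d) ∙ ab) ≡ time f ((g ∙ ab) ∙ s) + 147
mapAccStep-time f g s d ab = regroup (time f ((g ∙ ab) ∙ s))
  where
  regroup : ∀ t → (4 + ((60 + t) + (4 + (4 + (9 + 9))))) + 57 ≡ t + 147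
  regroup = solve-∀

module _ (step : Tm ((G ⊗ A ⊗ B) ⊗ S) (S ⊗ C)) {D} (γ : El G D) where

  private
    stepFun : El A D → El B D → El S D → El S D × El C D
    stepFun a b s = step .fun ((γ , a , b) , s)

    rawStep : Tree → Tree
    rawStep = ⟦ mapAccStep (step .raw) ⟧F

    state : El S D × Vec (El C D) n → Tree
    state (s , ws) = enc S s ∙ encVec C ws

    rawStep-correct : ∀ a b (r : El S D × Vec (El C D) n) →
      rawStep (enc G γ ∙ state r ∙ (enc A a ∙ enc B b)) ≡
      (let s , c = stepFun a b (proj₁ r) in state (s , c ∷ proj₂ r))
    rawStep-correct a b (s , ws) =
      cong (λ t → head t ∙ tail t ∙ encVec C ws) (step .sound ((γ , a , b) , s))

  iterList-mapAcc : ∀ z acc (as : Vec (El A D) n) (bs : Vec (El B D) n) →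
    iterList rawStep (enc G γ) (enc S z ∙ nil) (zipRevOnto A B acc as bs) ≡
    iterList rawStep (enc G γ) (state (mapAcc stepFun z as bs)) acc
  iterList-mapAcc z acc [] []             = refl
  iterList-mapAcc z acc (a ∷ as) (b ∷ bs) = trans (iterList-mapAcc z _ as bs)
    (cong (λ t → iterList rawStep (enc G γ) t acc) (rawStep-correct a b (mapAcc stepFun z as bs)))

  -- The 182 consists of the 147 units of rearrangement in `mapAccStep` and 35 units for one turn of
  -- the loop itself.
  iterTime-mapAcc : ∀ z acc (as : Vec (El A D) n) (bs : Vec (El B D) n) →
    iterTime rawStep (time (mapAccStep (step .raw))) (enc G γ) (enc S z ∙ nil) (zipRevOnto A B acc as bs) ≤
    n * (step .steps D + 182) +
    iterTime rawStep (time (mapAccStep (step .raw))) (enc G γ) (state (mapAcc stepFun z as bs)) acc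
  iterTime-mapAcc z acc [] []                       = ≤-refl
  iterTime-mapAcc {n = suc n} z acc (a ∷ as) (b ∷ bs) = begin
    iterTime rawStep t _ (enc S z ∙ nil) (zipRevOnto A B ((enc A a ∙ enc B b) ∙ acc) as bs)
      ≤⟨ iterTime-mapAcc z _ as bs ⟩
    n * T + (4 + (((4 + (12 + (t (enc G γ ∙ state r ∙ (enc A a ∙ enc B b)) + 15)))) +
      iterTime rawStep t (enc G γ) (rawStep (enc G γ ∙ state r ∙ (enc A a ∙ enc B b))) acc))
      ≡⟨ cong (λ x → n * T + (4 + ((4 + (12 + (t (enc G γ ∙ state r ∙ (enc A a ∙ enc B b)) + 15))) +
           iterTime rawStep t (enc G γ) x acc))) (rawStep-correct a b r) ⟩
    n * T + (4 + (((4 + (12 + (t (enc G γ ∙ state r ∙ (enc A a ∙ enc B b)) + 15)))) + R))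
      ≤⟨ +-monoʳ-≤ (n * T) (+-monoʳ-≤ 4 (+-monoˡ-≤ R (+-monoʳ-≤ 16 (+-monoˡ-≤ 15 step≤)))) ⟩
    n * T + (4 + ((16 + ((step .steps D + 147) + 15)) + R))
      ≡⟨ regroup (n * T) (step .steps D) R ⟩
    suc n * T + R ∎
    where
    open ≤-Reasoning
    t = time (mapAccStep (step .raw))
    T = step .steps D + 182
    r = mapAcc stepFun z as bs
    R = iterTime rawStep t (enc G γ) (state (mapAcc stepFun z (a ∷ as) (b ∷ bs))) acc
    step≤ : t (enc G γ ∙ state r ∙ (enc A a ∙ enc B b)) ≤ step .steps D + 147
    step≤ = ≤-trans
      (≤-reflexive (mapAccStep-time (step .raw) (enc G γ) (enc S (proj₁ r)) (encVec C (proj₂ r)) _))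
      (+-monoˡ-≤ 147 (step .time≤ _))
    regroup : ∀ m s r → m + (4 + ((16 + ((s + 147) + 15)) + r)) ≡ ((s + 182) + m) + r
    regroup = solve-∀

mapAccT : ∀ {i} → Tm ((G ⊗ A ⊗ B) ⊗ S) (S ⊗ C) →
          Tm G S → Tm G (vec i A) → Tm G (vec i B) → Tm G (S ⊗ vec i C)
mapAccT {G} {A} {B} {S} {C} {i} step z as bs = record
  { fun   = λ γ → mapAcc (λ a b s → step .fun ((γ , a , b) , s)) (z .fun γ) (as .fun γ) (bs .fun γ)
  ; raw   = mapAccFun
  ; sound = λ {D} γ → trans
      (cong₂ (iterList ⟦ mapAccStep (step .raw) ⟧F (enc G {D} γ)) (cong (_∙ nil) (z .sound γ)) (zipped γ))
      (iterList-mapAcc step γ (z .fun γ) nil (as .fun γ) (bs .fun γ))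
  ; poly  =
      poly-+ (poly-+ (poly-+ (poly-+ (poly-+ (z .poly) (bs .poly)) (as .poly))
        (poly-+ (poly-* (poly-dim i) (poly-const 137)) (poly-const 4)))
        (poly-+ (poly-* (poly-dim i) (poly-+ (step .poly) (poly-const 182))) (poly-const 4)))
        (poly-const 167)
  ; time≤ = timed
  }
  where
  zipRevFun′ mapAccFun : Fun
  zipRevFun′ = zipRevFun (as .raw) (bs .raw)
  mapAccFun  =
    loopF (mapAccStep (step .raw)) ∘F pairF idF (pairF (pairF (z .raw) nilF) zipRevFun′)

  zipped : ∀ {D} (γ : El G D) →
    ⟦ zipRevFun′ ⟧F (enc G γ) ≡ zipRevOnto A B nil (as .fun γ) (bs .fun γ)
  zipped γ = trans
    (cong₂ (λ x y → head (iterList ⟦ zipRevStep ⟧F nil (nil ∙ y) x)) (as .sound γ) (bs .sound γ))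
    (cong head (zipRev-correct A B nil (as .fun γ) (bs .fun γ)))

  timed : ∀ {D} (γ : El G D) → time mapAccFun (enc G γ) ≤
    z .steps D + bs .steps D + as .steps D + (D i * 137 + 4) +
    (D i * (step .steps D + 182) + 4) + 167
  timed {D} γ = begin
    time mapAccFun (enc G γ)
      ≡⟨ regroup (time (z .raw) (enc G γ)) (time (bs .raw) (enc G γ)) (time (as .raw) (enc G γ)) zipTime loopTime ⟩
    time (z .raw) (enc G γ) + time (bs .raw) (enc G γ) + time (as .raw) (enc G γ) + zipTime + loopTime + 167
      ≤⟨ +-monoˡ-≤ 167 (+-mono-≤ (+-mono-≤ (+-mono-≤ (+-mono-≤
           (z .time≤ γ) (bs .time≤ γ)) (as .time≤ γ)) zipTime≤) loopTime≤) ⟩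
    z .steps D + bs .steps D + as .steps D + (D i * 137 + 4) +
      (D i * (step .steps D + 182) + 4) + 167 ∎
    where
    open ≤-Reasoning
    zipTime loopTime : ℕ
    zipTime  = iterTime ⟦ zipRevStep ⟧F (time zipRevStep) nil
                 (nil ∙ ⟦ bs .raw ⟧F (enc G γ)) (⟦ as .raw ⟧F (enc G γ))
    loopTime = iterTime ⟦ mapAccStep (step .raw) ⟧F (time (mapAccStep (step .raw))) (enc G γ)
                 (⟦ z .raw ⟧F (enc G γ) ∙ nil) (⟦ zipRevFun′ ⟧F (enc G γ))

    zipTime≤ : zipTime ≤ D i * 137 + 4
    zipTime≤ = ≤-reflexive (trans
      (cong₂ (λ x y → iterTime ⟦ zipRevStep ⟧F (time zipRevStep) nil (nil ∙ y) x) (as .sound γ) (bs .sound γ))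
      (zipRev-time A B nil (as .fun γ) (bs .fun γ)))

    loopTime≤ : loopTime ≤ D i * (step .steps D + 182) + 4
    loopTime≤ = ≤-trans
      (≤-reflexive (cong₂ (λ x y → iterTime ⟦ mapAccStep (step .raw) ⟧F (time (mapAccStep (step .raw)))
        (enc G γ) (x ∙ nil) y) (z .sound γ) (zipped γ)))
      (iterTime-mapAcc step γ (z .fun γ) nil (as .fun γ) (bs .fun γ))

    regroup : ∀ z b a i j →
      (4 + (2 + (8 + ((4 + ((4 + (z + (8 + (2 + 9)))) + (8 + (((
        (4 + (2 + (8 + ((4 + ((4 + (2 + (8 + (b + 9)))) + (8 + (a + 9)))) + 9))))
        + (11 + (i + 4))) + 3) + 9)))) + 9)))) + (11 + (j + 4)) ≡
      z + b + a + i + j + 167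
    regroup = solve-∀

-- The algorithm

-- Price, owner and share of the owner; price 0 means that there is no owner.
Entry : ℕ → Set
Entry u = ℕ × Subset u × Subset u

-- Expressed through `mapAcc` with trivial outputs because that is the loop with a compiled form.
foldVec : {X Z : Set} → (X → Z → Z) → Z → Vec X n → Z
foldVec f z xs = proj₁ (mapAcc (λ x _ s → f x s , tt) z xs xs)

repeat : {Z : Set} → (Z → Z) → ℕ → Z → Z
repeat f zero    z = z
repeat f (suc k) z = f (repeat f k z)

sizeOf : Subset n → ℕ
sizeOf = foldVec (λ x k → choose x (suc k) k) 0

lessSize : ℕ → Subset n → ℕ
lessSize = foldVec (λ x k → choose x (pred k) k)

-- Truncated subtraction: suc s ∸ ∣ p ∣ is 1 only if ∣ p ∣ ≡ s.
hasSize : ℕ → Subset n → Bool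
hasSize s p = choose (isZero (lessSize (suc s) p)) false (isZero (pred (lessSize (suc s) p)))

candidates : ∀ {u} → ℕ → Vec Bool n → Vec (Entry u) n → Vec Bool n
candidates level S tb =
  proj₂ (mapAcc (λ x e _ → tt , choose x (isZero (proj₁ e ∸ level)) false) tt S tb)

-- Serves both phases. In the auction `M` has at most one element, whose owner, if any, returns to
-- the worklist; in the greedy phase `M` consists of free elements and nobody is evicted.
update : ∀ {u} → Subset u → Subset u → Vec Bool n → List (Subset u) → Vec (Entry u) n →
         List (Subset u) × Vec (Entry u) n
update S A M wl tb = mapAcc (λ m e w →
  choose m (choose (isZero (proj₁ e)) w (proj₁ (proj₂ e) ∷ w) , (suc (proj₁ e) , S , A)) (w , e)) wl M tb

collect : ∀ {u} → Vec (Entry u) n → List (Subset u × Subset u)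
collect = foldVec (λ e o → choose (isZero (proj₁ e)) o (proj₂ e ∷ o)) []

-- A budget b is exhausted after ⌈ b / d ⌉ payments of d; likewise in pay below.
trim : {Z : Set} → ℕ → ℕ × List Z × List Z → ℕ × List Z × List Z
trim d s = choose (isZero (proj₁ s)) s
  (caseList (proj₁ (proj₂ s)) s (λ p rest → proj₁ s ∸ d , rest , p ∷ proj₂ (proj₂ s)))

module Algorithm (q L : ℕ) where

  pay : ℕ → Vec Bool n → ℕ × Vec Bool n
  pay b c = mapAcc (λ x _ b → choose x (choose (isZero b) (b , false) (b ∸ q , true)) (b , false)) b c c

  -- One selection rule for both phases: for a nonempty set of fewer than q elements the number
  -- ⌈|S|/q⌉ is 1, so a successful mark is a single element.
  mark : ∀ {u} → ℕ → Subset u → Vec (Entry u) u → ℕ × Subset u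
  mark level S tb = pay (sizeOf S) (candidates level S tb)

  -- Levels are tried upwards from 0 with `level + r ≡ L`, so the first success hits a cheapest
  -- element. At the end of the levels the set is gone from the worklist without having bought
  -- anything.
  bid : ∀ {u} → ℕ → ℕ → Subset u → List (Subset u) × Vec (Entry u) u →
        List (Subset u) × Vec (Entry u) u
  bid zero    level S st = st
  bid (suc r) level S st =
    let m = mark level S (proj₂ st) in
    choose (isZero (proj₁ m)) (update S (proj₂ m) (proj₂ m) (proj₁ st) (proj₂ st))
           (bid r (suc level) S st)

  auctionStep : ∀ {u} → List (Subset u) × Vec (Entry u) u → List (Subset u) × Vec (Entry u) u
  auctionStep st = caseList (proj₁ st) st (λ S wl → bid L 0 S (wl , proj₂ st))

  emptyTable : ∀ u → Vec (Entry u) u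
  emptyTable u = Vec.replicate u (0 , Vec.replicate u false , Vec.replicate u false)

  smallSets : ∀ {u} → Vec (Subset u) n → List (Subset u)
  smallSets = foldVec (λ S w → choose (isZero (suc (sizeOf S) ∸ q)) (S ∷ w) w) []

  auction : ∀ {u} → Vec (Subset u) n → List (Subset u) × Vec (Entry u) u
  -- This makes n + uL steps, the initial bound on `measure`. The loops are nested since a loop can
  -- run for a dimension but not for a product; `L` is a constant of the program.
  auction {n} {u} 𝒮 = repeat (repeat auctionStep u) L (repeat auctionStep n (smallSets 𝒮 , emptyTable u))

  greedyStep : ∀ {u} → ℕ → Subset u → List (Subset u × Subset u) × Vec (Entry u) u →
               List (Subset u × Subset u) × Vec (Entry u) u
  greedyStep s S st = choose (hasSize s S)
    (let m = mark 0 S (proj₂ st) in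
     choose (isZero (proj₁ m)) ((S , proj₂ m) ∷ proj₁ st , proj₂ (update S (proj₂ m) (proj₂ m) [] (proj₂ st))) st)
    st

  greedyRound : ∀ {u} → Vec (Subset u) n → ℕ × List (Subset u × Subset u) × Vec (Entry u) u →
                ℕ × List (Subset u × Subset u) × Vec (Entry u) u
  greedyRound 𝒮 st = suc (proj₁ st) , foldVec (greedyStep (proj₁ st)) (proj₂ st) 𝒮

  greedy : ∀ {u} → Vec (Subset u) n → Vec (Entry u) u → List (Subset u × Subset u)
  -- Instead of sorting there is one pass per size. The u passes treat the sizes from q to q + u -
  -- 1, and no set has more than u elements.
  greedy {u = u} 𝒮 tb = proj₁ (proj₂ (repeat (greedyRound 𝒮) u (q , collect tb , tb)))

module Packing (q L a d : ℕ) where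
  open Algorithm q L

  -- With `a` = d ∸ p the budget m (d - p) is spent in portions of d, hence on ⌈(1 - δ) m⌉ pairs; m
  -- rounds are enough because m (d - p) ≤ d m. For p > d truncation makes the budget 0.
  pack : ∀ {u} → Vec (Subset u) n → ℕ → List (Subset u × Subset u)
  pack 𝒮 m = proj₂ (proj₂ (repeat (trim d) m (repeat (a +_) m 0 , greedy 𝒮 (proj₂ (auction 𝒮)) , [])))

-- The algorithm as a polynomial-time function

private variable
  i : Dim

letT : Tm G A → Tm (G ⊗ A) B → Tm G B
letT a b = b ∘T pairT idT a

foldT : Tm ((G ⊗ A) ⊗ S) S → Tm G S → Tm G (vec i A) → Tm G S
foldT f z as = fstT ∘T mapAccT
  (pairT (f ∘T pairT (pairT (fstT ∘T fstT) (fstT ∘T sndT ∘T fstT)) sndT) ttT) z as as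

repeatT : Tm S S → Tm G (vec i A) → Tm G S → Tm G S
repeatT {S} {i = i} f v z = withFun (foldT (f ∘T sndT) z v)
  (λ {D} γ → repeat (f .fun {D}) (D i) (z .fun γ)) (λ {D} γ → eq {D = D} (z .fun γ) (v .fun γ))
  where
  eq : ∀ {D X} s (xs : Vec X n) → foldVec (λ _ → f .fun {D}) s xs ≡ repeat (f .fun {D}) n s
  eq s []       = refl
  eq {D = D} s (x ∷ xs) = cong (f .fun {D}) (eq {D = D} s xs)

#0 : Tm (G ⊗ A) A
#0 = sndT

#1 : Tm ((G ⊗ A) ⊗ B) A
#1 = sndT ∘T fstT

sub entry table : Ty
sub   = vec #U bool
entry = nat ⊗ sub ⊗ sub
table = vec #U entry

sizeOfT : Tm sub nat
sizeOfT = withFun (foldT (ifT #1 (sucT ∘T #0) #0) zeroT idT) sizeOf (λ _ → refl)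

lessSizeT : Tm (nat ⊗ sub) nat
lessSizeT = withFun (foldT (ifT #1 (predT ∘T #0) #0) fstT sndT)
  (λ x → lessSize (proj₁ x) (proj₂ x)) (λ _ → refl)

hasSizeT : Tm (nat ⊗ sub) bool
hasSizeT = withFun
  (letT (lessSizeT ∘T pairT (sucT ∘T fstT) sndT)
    (ifT (isZeroT ∘T #0) falseT (isZeroT ∘T predT ∘T #0)))
  (λ x → hasSize (proj₁ x) (proj₂ x)) (λ _ → refl)

candidatesT : ℕ → Tm (sub ⊗ table) sub
candidatesT level = withFun
  (sndT ∘T mapAccT
    (pairT ttT (ifT (fstT ∘T #1) (isZeroT ∘T minusT level ∘T fstT ∘T sndT ∘T #1) falseT)) ttT fstT sndT)
  (λ x → candidates level (proj₁ x) (proj₂ x)) (λ _ → refl)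

updateT : Tm ((sub ⊗ sub) ⊗ list sub ⊗ table) (list sub ⊗ table)
updateT = withFun
  (mapAccT
    (ifT (fstT ∘T #1)
      (pairT (ifT (isZeroT ∘T fstT ∘T sndT ∘T #1) #0 (consT (fstT ∘T sndT ∘T sndT ∘T #1) #0))
             (pairT (sucT ∘T fstT ∘T sndT ∘T #1) (fstT ∘T fstT ∘T fstT)))
      (pairT #0 (sndT ∘T #1)))
    (fstT ∘T sndT) (sndT ∘T fstT) (sndT ∘T sndT))
  (λ x → update (proj₁ (proj₁ x)) (proj₂ (proj₁ x)) (proj₂ (proj₁ x)) (proj₁ (proj₂ x)) (proj₂ (proj₂ x)))
  (λ _ → refl)

collectT : Tm table (list (sub ⊗ sub))
collectT = withFun
  (foldT (ifT (isZeroT ∘T fstT ∘T #1) #0 (consT (sndT ∘T #1) #0)) []T idT) collect (λ _ → refl)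

trimT : ℕ → Tm (nat ⊗ list A ⊗ list A) (nat ⊗ list A ⊗ list A)
trimT d = withFun
  (ifT (isZeroT ∘T fstT) idT
    (caseListT (fstT ∘T sndT) idT
      (pairT (minusT d ∘T fstT ∘T fstT)
             (pairT (sndT ∘T sndT) (consT (fstT ∘T sndT) (sndT ∘T sndT ∘T fstT))))))
  (trim d) (λ _ → refl)

module AlgorithmT (q L : ℕ) where
  open Algorithm q L

  payT : Tm (nat ⊗ sub) (nat ⊗ sub)
  payT = withFun
    (mapAccT
      (ifT (fstT ∘T #1)
        (ifT (isZeroT ∘T #0) (pairT #0 falseT) (pairT (minusT q ∘T #0) trueT))
        (pairT #0 falseT))
      fstT sndT sndT)
    (λ x → pay (proj₁ x) (proj₂ x)) (λ _ → refl)

  markT : ℕ → Tm (sub ⊗ table) (nat ⊗ sub)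
  markT level = withFun (payT ∘T pairT (sizeOfT ∘T fstT) (candidatesT level))
    (λ x → mark level (proj₁ x) (proj₂ x)) (λ _ → refl)

  -- `L` depends on δ alone, so the search through the levels is unrolled into the program text.
  bidT : ℕ → ℕ → Tm (sub ⊗ list sub ⊗ table) (list sub ⊗ table)
  bidT r level = withFun (go r level) (λ x → bid r level (proj₁ x) (proj₂ x)) (λ {D} → eq D r level)
    where
    go : ℕ → ℕ → Tm (sub ⊗ list sub ⊗ table) (list sub ⊗ table)
    go zero    level = sndT
    go (suc r) level = letT (markT level ∘T pairT fstT (sndT ∘T sndT))
      (ifT (isZeroT ∘T fstT ∘T #0)
        (updateT ∘T pairT (pairT (fstT ∘T fstT) (sndT ∘T #0)) (sndT ∘T fstT))
        (go r (suc level) ∘T fstT))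
    eq : ∀ D r level x → go r level .fun {D} x ≡ bid r level (proj₁ x) (proj₂ x)
    eq D zero    level x = refl
    eq D (suc r) level x = cong (choose (isZero (proj₁ m)) (update (proj₁ x) (proj₂ m) (proj₂ m) _ _))
      (eq D r (suc level) x)
      where m = mark level (proj₁ x) (proj₂ (proj₂ x))

  auctionStepT : Tm (list sub ⊗ table) (list sub ⊗ table)
  auctionStepT = withFun
    (caseListT fstT idT (bidT L 0 ∘T pairT (fstT ∘T sndT) (pairT (sndT ∘T sndT) (sndT ∘T fstT))))
    auctionStep (λ _ → refl)

  falsesT : Tm (vec #U unit) sub
  falsesT = withFun (sndT ∘T mapAccT (pairT ttT falseT) ttT idT idT)
    (λ {D} _ → Vec.replicate (D #U) false) eq
    where
    eq : ∀ xs → proj₂ (mapAcc (λ (_ _ _ : ⊤) → tt , false) tt xs xs) ≡ Vec.replicate n false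
    eq []       = refl
    eq (x ∷ xs) = cong (false ∷_) (eq xs)

  emptyTableT : Tm (vec #U unit) table
  emptyTableT = withFun (letT falsesT
      (sndT ∘T mapAccT (pairT ttT (pairT zeroT (pairT (sndT ∘T fstT ∘T fstT) (sndT ∘T fstT ∘T fstT)))) ttT fstT fstT))
    (λ {D} _ → emptyTable (D #U)) (λ {D} xs → eq _ xs)
    where
    eq : ∀ {X : Set} (x : X) (us : Vec ⊤ n) →
      proj₂ (mapAcc (λ (_ _ _ : ⊤) → tt , x) tt us us) ≡ Vec.replicate n x
    eq x []       = refl
    eq x (_ ∷ us) = cong (x ∷_) (eq x us)

  smallSetsT : Tm (vec #N sub) (list sub)
  smallSetsT = withFun
    (foldT (ifT (isZeroT ∘T minusT q ∘T sucT ∘T sizeOfT ∘T #1) (consT #1 #0) #0) []T idT)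
    smallSets (λ _ → refl)

  auctionT : Tm (vec #U unit ⊗ vec #N sub) (list sub ⊗ table)
  auctionT = withFun (go L) (λ x → auction (proj₂ x)) (λ {D} → eq D L)
    where
    go : ℕ → Tm (vec #U unit ⊗ vec #N sub) (list sub ⊗ table)
    go zero    = repeatT auctionStepT sndT (pairT (smallSetsT ∘T sndT) (emptyTableT ∘T fstT))
    go (suc k) = repeatT auctionStepT fstT (go k)
    eq : ∀ D k x → go k .fun {D} x ≡
      repeat (repeat auctionStep (D #U)) k (repeat auctionStep (D #N) (smallSets (proj₂ x) , emptyTable (D #U)))
    eq D zero    x = refl
    eq D (suc k) x = cong (repeat auctionStep (D #U)) (eq D k x)

  greedyStepT : Tm ((nat ⊗ sub) ⊗ list (sub ⊗ sub) ⊗ table) (list (sub ⊗ sub) ⊗ table)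
  greedyStepT = withFun
    (ifT (hasSizeT ∘T fstT)
      (letT (markT 0 ∘T pairT (sndT ∘T fstT) (sndT ∘T sndT))
        (ifT (isZeroT ∘T fstT ∘T #0)
          (pairT (consT (pairT (sndT ∘T fstT ∘T fstT) (sndT ∘T #0)) (fstT ∘T sndT ∘T fstT))
                 (sndT ∘T updateT ∘T pairT (pairT (sndT ∘T fstT ∘T fstT) (sndT ∘T #0))
                                           (pairT []T (sndT ∘T sndT ∘T fstT))))
          (sndT ∘T fstT)))
      sndT)
    (λ x → greedyStep (proj₁ (proj₁ x)) (proj₂ (proj₁ x)) (proj₂ x)) (λ _ → refl)

  greedyRoundT : Tm (vec #N sub ⊗ nat ⊗ list (sub ⊗ sub) ⊗ table)
                    (vec #N sub ⊗ nat ⊗ list (sub ⊗ sub) ⊗ table)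
  greedyRoundT = withFun
    (pairT fstT (pairT (sucT ∘T fstT ∘T sndT)
      (foldT (greedyStepT ∘T pairT (pairT (fstT ∘T sndT ∘T fstT ∘T fstT) #1) #0) (sndT ∘T sndT) fstT)))
    (λ x → proj₁ x , greedyRound (proj₁ x) (proj₂ x)) (λ _ → refl)

  greedyT : Tm (vec #U unit ⊗ vec #N sub ⊗ table) (list (sub ⊗ sub))
  greedyT = withFun
    (fstT ∘T sndT ∘T sndT ∘T repeatT greedyRoundT fstT
      (pairT (fstT ∘T sndT) (pairT (plusT q ∘T zeroT) (pairT (collectT ∘T sndT ∘T sndT) (sndT ∘T sndT)))))
    (λ x → greedy (proj₁ (proj₂ x)) (proj₂ (proj₂ x)))
    (λ {D} x → eq (D #U) (proj₁ (proj₂ x)) (proj₂ (proj₂ x)))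
    where
    -- The body of `repeatT` sees the state only, so `𝒮` travels in the state and has to be shown
    -- constant.
    invariant : ∀ {u} k (𝒮 : Vec (Subset u) n) st →
      repeat (λ x → proj₁ x , greedyRound (proj₁ x) (proj₂ x)) k (𝒮 , st) ≡ (𝒮 , repeat (greedyRound 𝒮) k st)
    invariant zero    𝒮 st = refl
    invariant (suc k) 𝒮 st = cong (λ x → proj₁ x , greedyRound (proj₁ x) (proj₂ x)) (invariant k 𝒮 st)

    eq : ∀ u (𝒮 : Vec (Subset u) n) tb →
      proj₁ (proj₂ (proj₂ (repeat (λ x → proj₁ x , greedyRound (proj₁ x) (proj₂ x)) u
        (𝒮 , q + 0 , collect tb , tb)))) ≡ greedy 𝒮 tb
    eq u 𝒮 tb rewrite +-identityʳ q = cong (λ x → proj₁ (proj₂ (proj₂ x))) (invariant u 𝒮 _)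

module PackingT (q L a d : ℕ) where
  open AlgorithmT q L
  open Packing q L a d

  packT : Tm (vec #U unit ⊗ vec #N sub ⊗ vec #M unit) (list (sub ⊗ sub))
  packT = withFun
    (sndT ∘T sndT ∘T repeatT (trimT d) (sndT ∘T sndT)
      (pairT (repeatT (plusT a) (sndT ∘T sndT) zeroT)
        (pairT (greedyT ∘T pairT fstT (pairT (fstT ∘T sndT) (sndT ∘T auctionT ∘T pairT fstT (fstT ∘T sndT)))) []T)))
    (λ {D} x → pack (proj₁ (proj₂ x)) (D #M)) (λ _ → refl)

-- Deterministic programs solve search problems

allBits : ∀ T → List (Vec Bool T)
allBits zero    = [] ∷ []
allBits (suc T) = map (true ∷_) (allBits T) ++ map (false ∷_) (allBits T)

length-allBits : ∀ T → length (allBits T) ≡ 2 ^ T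
length-allBits zero    = refl
length-allBits (suc T) = begin
  length (allBits (suc T))
    ≡⟨ length-++ (map (true ∷_) (allBits T)) ⟩
  length (map (true ∷_) (allBits T)) + length (map (false ∷_) (allBits T))
    ≡⟨ cong₂ _+_ (length-map _ (allBits T)) (length-map _ (allBits T)) ⟩
  length (allBits T) + length (allBits T)
    ≡⟨ cong₂ _+_ (length-allBits T) (trans (length-allBits T) (sym (+-identityʳ _))) ⟩
  2 ^ suc T ∎
  where open ≡-Reasoning

allBits-unique : ∀ T → Unique (allBits T)
allBits-unique zero    = [] ∷ []
allBits-unique (suc T) = Unique.++⁺
  (Unique.map⁺ ∷-injectiveʳ (allBits-unique T))
  (Unique.map⁺ ∷-injectiveʳ (allBits-unique T))
  λ { {v} (p , q) → differ {v} (∈-map⁻ (true ∷_) p) (∈-map⁻ (false ∷_) q) }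
  where
  differ : ∀ {v : Vec Bool (suc T)} → ∃ (λ x → x List.∈ allBits T × v ≡ true ∷ x) →
           (∃ λ y → y List.∈ allBits T × v ≡ false ∷ y) → ⊥
  differ (_ , _ , refl) (_ , _ , ())

certain : ∀ T {E : Vec Bool T → Set} → (∀ ω → E ω) → ProbAtLeast⅔ T E
certain T e = allBits T , allBits-unique T , All.universal e _ ,
  ≤-trans (*-monoˡ-≤ (2 ^ T) {2} {3} (s≤s (s≤s z≤n))) (≤-reflexive (cong (3 *_) (sym (length-allBits T))))

-- The numbers u and m serve as loop counters, hence as vectors of units.
InputTy : Ty
InputTy = vec #U unit ⊗ vec #N sub ⊗ vec #M unit

dims : Instance → Dims
dims I #U = Instance.u I
dims I #N = length (Instance.𝒮 I)
dims I #M = Instance.m I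

input : ∀ I → El InputTy (dims I)
input I = Vec.replicate _ tt , Vec.fromList (Instance.𝒮 I) , Vec.replicate _ tt

encInput : Instance → Tree
encInput I = enc InputTy {dims I} (input I)

enc-input : ∀ I → encInput I ≡ encodeInstance I
enc-input I = cong₂ _∙_ (units u)
  (cong₂ _∙_ (cong (encodeList encodeSubset) (toList∘fromList 𝒮)) (units m))
  where
  open Instance I
  units : ∀ n → encodeList (enc unit {dims I}) (Vec.toList (Vec.replicate n tt)) ≡ encodeℕ n
  units zero    = refl
  units (suc n) = cong (nil ∙_) (units n)

size-positive : ∀ t → 1 ≤ size t
size-positive nil     = s≤s z≤n
size-positive (_ ∙ _) = s≤s z≤n

length≤size : {X : Set} (f : X → Tree) (xs : List X) → length xs ≤ size (encodeList f xs)
length≤size f []       = z≤n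
length≤size f (x ∷ xs) = s≤s (≤-trans (length≤size f xs) (m≤n+m _ (size (f x))))

n≤size : ∀ n → n ≤ size (encodeℕ n)
n≤size zero    = z≤n
n≤size (suc n) = s≤s (m≤n⇒m≤1+n (n≤size n))

scale≤size : ∀ I → scale (dims I) ≤ size (encodeInstance I)
scale≤size I = s≤s (begin
  u + length 𝒮 + m
    ≡⟨ +-assoc u (length 𝒮) m ⟩
  u + (length 𝒮 + m)
    ≤⟨ +-mono-≤ (n≤size u) (m≤n⇒m≤1+n (+-mono-≤ (length≤size encodeSubset 𝒮) (n≤size m))) ⟩
  size (encodeℕ u) + size (encodeList encodeSubset 𝒮 ∙ encodeℕ m) ∎)
  where
  open Instance I
  open ≤-Reasoning

program : Tm InputTy B → Program
program t = record { extraVars = 1 ; body = compile (t .raw) }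

-- Compiled code contains no `flip`, so one and the same run serves every bit string.
deterministic : (t : Tm InputTy B) {Promise : Instance → Set} {Correct : Instance → Tree → Set} →
  (∀ I → Promise I → Correct I (enc B {dims I} (t .fun {dims I} (input I)))) →
  SolvesInRandomizedPolyTime (program t) encodeInstance Promise Correct
deterministic {B} t correct with t .poly
... | c , k , bounded = record
  { c        = c
  ; k        = k
  ; halts    = λ I ω → _ , _ , run I (Vec.toList ω) , (begin
      time (t .raw) (encodeInstance I)
        ≡⟨ cong (time (t .raw)) (enc-input I) ⟨
      time (t .raw) (encInput I)
        ≤⟨ t .time≤ {dims I} (input I) ⟩
      t .steps (dims I)
        ≤⟨ bounded (dims I) ⟩
      c * scale (dims I) ^ k
        ≤⟨ *-monoʳ-≤ c (^-monoˡ-≤ k (scale≤size I)) ⟩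
      c * size (encodeInstance I) ^ k ∎)
  ; succeeds = λ I promise → certain _ λ ω → _ , _ , run I (Vec.toList ω) , correct I promise
  }
  where
  open ≤-Reasoning
  run : ∀ I ω → Runs (program t) (encodeInstance I) ω (time (t .raw) (encodeInstance I))
    (enc B {dims I} (t .fun {dims I} (input I)))
  run I ω = _ , _ , compile-correct (t .raw) (encodeInstance I) nil ω ,
    trans (cong ⟦ t .raw ⟧F (sym (enc-input I))) (t .sound {dims I} (input I))

-- Elementary properties of the algorithm

foldVec-fromList : {X Z : Set} (f : X → Z → Z) (z : Z) (xs : List X) →
  foldVec f z (Vec.fromList xs) ≡ List.foldr f z xs
foldVec-fromList f z []       = refl
foldVec-fromList f z (x ∷ xs) = cong (f x) (foldVec-fromList f z xs)

sizeOf-∣∣ : (p : Subset n) → sizeOf p ≡ ∣ p ∣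
sizeOf-∣∣ []          = refl
sizeOf-∣∣ (true ∷ p)  = cong suc (sizeOf-∣∣ p)
sizeOf-∣∣ (false ∷ p) = sizeOf-∣∣ p

lessSize-∣∣ : ∀ c (p : Subset n) → lessSize c p ≡ c ∸ ∣ p ∣
lessSize-∣∣ c []          = refl
lessSize-∣∣ c (true ∷ p)  = trans (cong pred (lessSize-∣∣ c p)) (pred[m∸n]≡m∸[1+n] c ∣ p ∣)
lessSize-∣∣ c (false ∷ p) = lessSize-∣∣ c p

hasSize-true : ∀ s (p : Subset n) → hasSize s p ≡ true → ∣ p ∣ ≡ s
hasSize-true s p e rewrite lessSize-∣∣ (suc s) p with suc s ∸ ∣ p ∣ in d
... | suc zero = suc-injective (begin
  suc ∣ p ∣             ≡⟨ cong (_+ ∣ p ∣) d ⟨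
  suc s ∸ ∣ p ∣ + ∣ p ∣ ≡⟨ m∸n+n≡m (<⇒≤ (m<n⇒m∸o≢0 d)) ⟩
  suc s                 ∎)
  where
  open ≡-Reasoning
  m<n⇒m∸o≢0 : suc s ∸ ∣ p ∣ ≡ 1 → ∣ p ∣ < suc s
  m<n⇒m∸o≢0 d = m∸n≢0⇒n<m λ z → case trans (sym d) z of λ ()

hasSize-false : ∀ s (p : Subset n) → hasSize s p ≡ false → ∣ p ∣ ≢ s
hasSize-false s p e refl rewrite lessSize-∣∣ (suc ∣ p ∣) p | m+n∸n≡m 1 ∣ p ∣ = case e of λ ()

-- Tables of prices, owners and shares

price : Vec (Entry w) n → Fin n → ℕ
price tb x = proj₁ (lookup tb x)

owner : Vec (Entry w) n → Fin n → Subset w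
owner tb x = proj₁ (proj₂ (lookup tb x))

share : Vec (Entry w) n → Fin n → Subset w
share tb x = proj₂ (proj₂ (lookup tb x))

candidates⁻ : ∀ l (S : Vec Bool n) (tb : Vec (Entry w) n) {x} →
  x ∈ candidates l S tb → x ∈ S × price tb x ≤ l
candidates⁻ l (true ∷ S) (e ∷ tb) {zero} x∈c with proj₁ e ∸ l in d
candidates⁻ l (true ∷ S) (e ∷ tb) {zero} here | zero = here , m∸n≡0⇒m≤n d
candidates⁻ l (s ∷ S) (e ∷ tb) {suc x} (there x∈c) with candidates⁻ l S tb x∈c
... | x∈S , p≤l = there x∈S , p≤l

candidates⁺ : ∀ l (S : Vec Bool n) (tb : Vec (Entry w) n) {x} →
  x ∈ S → price tb x ≤ l → x ∈ candidates l S tb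
candidates⁺ l (true ∷ S) (e ∷ tb) here p≤l rewrite m≤n⇒m∸n≡0 p≤l = here
candidates⁺ l (s ∷ S) (e ∷ tb) (there x∈S) p≤l = there (candidates⁺ l S tb x∈S p≤l)

covered : Vec (Entry w) n → Subset n
covered = Vec.map (λ e → not (isZero (proj₁ e)))

covered⁻ : (tb : Vec (Entry w) n) {x : Fin n} → x ∈ covered tb → price tb x ≢ 0
covered⁻ ((suc p , _) ∷ tb) {zero} here ()
covered⁻ (e ∷ tb) {suc x} (there x∈c) = covered⁻ tb x∈c

covered⁺ : (tb : Vec (Entry w) n) {x : Fin n} → price tb x ≢ 0 → x ∈ covered tb
covered⁺ ((zero , _) ∷ tb)  {zero}  p≢0 = contradiction refl p≢0
covered⁺ ((suc _ , _) ∷ tb) {zero}  p≢0 = here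
covered⁺ (e ∷ tb)           {suc x} p≢0 = there (covered⁺ tb p≢0)

∣candidates∣+∣covered∣ : (S : Vec Bool n) (tb : Vec (Entry w) n) →
  ∣ candidates 0 S tb ∣ + ∣ S ∩ covered tb ∣ ≡ ∣ S ∣
∣candidates∣+∣covered∣ []          []                 = refl
∣candidates∣+∣covered∣ (false ∷ S) (e ∷ tb)           = ∣candidates∣+∣covered∣ S tb
∣candidates∣+∣covered∣ (true ∷ S)  ((zero , _) ∷ tb)  = cong suc (∣candidates∣+∣covered∣ S tb)
∣candidates∣+∣covered∣ (true ∷ S)  ((suc _ , _) ∷ tb) =
  trans (+-suc _ _) (cong suc (∣candidates∣+∣covered∣ S tb))

length-collect : (tb : Vec (Entry w) n) → length (collect tb) ≡ ∣ covered tb ∣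
length-collect []                 = refl
length-collect ((zero , _) ∷ tb)  = length-collect tb
length-collect ((suc _ , _) ∷ tb) = cong suc (length-collect tb)

collect-All : {P : Subset w × Subset w → Set} (tb : Vec (Entry w) n) →
  (∀ x → price tb x ≢ 0 → P (proj₂ (lookup tb x))) → All P (collect tb)
collect-All []                 p = []
collect-All ((zero , _) ∷ tb)  p = collect-All tb (p ∘ suc)
collect-All ((suc _ , _) ∷ tb) p = p zero (λ ()) ∷ collect-All tb (p ∘ suc)

collect-AllPairs : {R : Subset w × Subset w → Subset w × Subset w → Set} (tb : Vec (Entry w) n) →
  (∀ x y → x ≢ y → price tb x ≢ 0 → price tb y ≢ 0 → R (proj₂ (lookup tb x)) (proj₂ (lookup tb y))) →
  AllPairs R (collect tb)
collect-AllPairs []                 r = []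
collect-AllPairs ((zero , _) ∷ tb)  r =
  collect-AllPairs tb λ x y x≢y → r (suc x) (suc y) (x≢y ∘ Fin.suc-injective)
collect-AllPairs ((suc _ , _) ∷ tb) r =
  collect-All tb (λ y → r zero (suc y) (λ ()) (λ ())) ∷
  collect-AllPairs tb λ x y x≢y → r (suc x) (suc y) (x≢y ∘ Fin.suc-injective)

∣p∣≡0⇒p≡∅ : (p : Subset n) → ∣ p ∣ ≡ 0 → p ≡ ∅
∣p∣≡0⇒p≡∅ []          e = refl
∣p∣≡0⇒p≡∅ (false ∷ p) e = cong (false ∷_) (∣p∣≡0⇒p≡∅ p e)

∣p∣≡1⇒p≡⁅x⁆ : (p : Subset n) → ∣ p ∣ ≡ 1 → ∃ λ x → p ≡ ⁅ x ⁆
∣p∣≡1⇒p≡⁅x⁆ (true ∷ p)  e = zero , cong (true ∷_) (∣p∣≡0⇒p≡∅ p (suc-injective e))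
∣p∣≡1⇒p≡⁅x⁆ (false ∷ p) e with ∣p∣≡1⇒p≡⁅x⁆ p e
... | x , refl = suc x , refl

update-∅ : (S A : Subset w) (wl : List (Subset w)) (tb : Vec (Entry w) n) → update S A ∅ wl tb ≡ (wl , tb)
update-∅ S A wl []       = refl
update-∅ S A wl (e ∷ tb) rewrite update-∅ S A wl tb = refl

evict : Entry w → List (Subset w) → List (Subset w)
evict e wl = choose (isZero (proj₁ e)) wl (proj₁ (proj₂ e) ∷ wl)

update-⁅⁆ : (S A : Subset w) (x : Fin n) (wl : List (Subset w)) (tb : Vec (Entry w) n) →
  update S A ⁅ x ⁆ wl tb ≡ (evict (lookup tb x) wl , tb [ x ]≔ (suc (price tb x) , S , A))
update-⁅⁆ S A zero    wl (e ∷ tb) rewrite update-∅ S A wl tb = refl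
update-⁅⁆ S A (suc x) wl (e ∷ tb) rewrite update-⁅⁆ S A x wl tb = refl

price-update : (S A : Subset w) (M : Vec Bool n) (wl : List (Subset w)) (tb : Vec (Entry w) n) (x : Fin n) →
  price (proj₂ (update S A M wl tb)) x ≡ choose (lookup M x) (suc (price tb x)) (price tb x)
price-update S A (true ∷ M)  wl (e ∷ tb) zero    = refl
price-update S A (false ∷ M) wl (e ∷ tb) zero    = refl
price-update S A (true ∷ M)  wl (e ∷ tb) (suc x) = price-update S A M wl tb x
price-update S A (false ∷ M) wl (e ∷ tb) (suc x) = price-update S A M wl tb x

∣covered-update∣ : (S A : Subset w) (M : Vec Bool n) (wl : List (Subset w)) (tb : Vec (Entry w) n) →
  ∣ covered (proj₂ (update S A M wl tb)) ∣ ≤ ∣ covered tb ∣ + ∣ M ∣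
∣covered-update∣ S A []          wl []                 = z≤n
∣covered-update∣ S A (false ∷ M) wl ((zero , _) ∷ tb)  = ∣covered-update∣ S A M wl tb
∣covered-update∣ S A (false ∷ M) wl ((suc _ , _) ∷ tb) = s≤s (∣covered-update∣ S A M wl tb)
∣covered-update∣ S A (true ∷ M)  wl ((zero , _) ∷ tb)  =
  ≤-trans (s≤s (∣covered-update∣ S A M wl tb)) (≤-reflexive (sym (+-suc _ _)))
∣covered-update∣ S A (true ∷ M)  wl ((suc _ , _) ∷ tb) =
  s≤s (≤-trans (∣covered-update∣ S A M wl tb) (+-monoʳ-≤ _ (n≤1+n _)))

-- Paying a budget with candidates

module Pay (L : ℕ) where
  private q = suc L
  open Algorithm q L

  -- `paid` pins |M| down to ⌈b/q⌉. `short` says that all candidates were used and a positive budget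
  -- is left, hence q |c| < b.
  data PayResult (b : ℕ) (c : Vec Bool n) : ℕ × Vec Bool n → Set where
    paid  : ∀ {M} → b ≤ q * ∣ M ∣ → q * ∣ M ∣ < b + q → PayResult b c (0 , M)
    short : ∀ {r M} → b ≡ suc r + q * ∣ M ∣ → ∣ M ∣ ≡ ∣ c ∣ → PayResult b c (suc r , M)

  pay-⊆ : ∀ b (c : Vec Bool n) {x} → x ∈ proj₂ (pay b c) → x ∈ c
  pay-⊆ b (false ∷ c) (there x∈M) = there (pay-⊆ b c x∈M)
  pay-⊆ b (true ∷ c)  x∈M with isZero (proj₁ (pay b c))
  pay-⊆ b (true ∷ c)  here        | false = here
  pay-⊆ b (true ∷ c)  (there x∈M) | false = there (pay-⊆ b c x∈M)
  pay-⊆ b (true ∷ c)  (there x∈M) | true  = there (pay-⊆ b c x∈M)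

  pay-result : ∀ b (c : Vec Bool n) → PayResult b c (pay b c)
  pay-result zero [] = paid z≤n (subst (_< q) (sym (*-zeroʳ q)) (s≤s z≤n))
  pay-result (suc b) [] = short (sym (trans (cong (suc b +_) (*-zeroʳ q)) (+-identityʳ _))) refl
  pay-result b (false ∷ c) with pay b c | pay-result b c
  ... | _ | paid p₁ p₂  = paid p₁ p₂
  ... | _ | short p₁ p₂ = short p₁ p₂
  pay-result b (true ∷ c) with pay b c | pay-result b c
  ... | _ | paid p₁ p₂  = paid p₁ p₂
  -- The head is asked last. With q = suc L, paying q out of the remaining suc r leaves r ∸ L.
  ... | suc r , M | short refl p₂ with r ∸ L in d
  ...   | zero   = paid (exhausted r ∣ M ∣ (m∸n≡0⇒m≤n d)) (tight r ∣ M ∣)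
    where
    exhausted : ∀ r m → r ≤ L → suc r + q * m ≤ q * suc m
    exhausted r m r≤L = ≤-trans (+-monoˡ-≤ (q * m) (s≤s r≤L)) (≤-reflexive (sym (*-suc q m)))
    tight : ∀ r m → q * suc m < suc r + q * m + q
    tight r m = begin-strict
      q * suc m           ≡⟨ *-suc q m ⟩
      q + q * m           ≡⟨ +-comm q (q * m) ⟩
      q * m + q           <⟨ +-monoˡ-< q (m<n+m (q * m) {suc r} (s≤s z≤n)) ⟩
      suc r + q * m + q   ∎
      where open ≤-Reasoning
  ...   | suc r′ = short (leftover r r′ ∣ M ∣ d) (cong suc p₂)
    where
    leftover : ∀ r r′ m → r ∸ L ≡ suc r′ → suc r + q * m ≡ suc r′ + q * suc m
    leftover r r′ m d = begin
      suc r + q * m               ≡⟨ cong (λ k → suc k + q * m) (m∸n+n≡m {r} {L} L≤r) ⟨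
      suc (r ∸ L + L) + q * m     ≡⟨ cong (λ k → suc (k + L) + q * m) d ⟩
      suc (suc r′ + L) + q * m    ≡⟨ cong (_+ q * m) (sym (+-suc (suc r′) L)) ⟩
      suc r′ + q + q * m          ≡⟨ +-assoc (suc r′) q (q * m) ⟩
      suc r′ + (q + q * m)        ≡⟨ cong (suc r′ +_) (*-suc q m) ⟨
      suc r′ + q * suc m          ∎
      where
      open ≡-Reasoning
      L≤r : L ≤ r
      L≤r = <⇒≤ (m∸n≢0⇒n<m λ z → case trans (sym d) z of λ ())

-- Finite sums

sumF : (Fin n → ℕ) → ℕ
sumF {zero}  f = 0
sumF {suc n} f = f zero + sumF (f ∘ suc)

sumF-cong : {f g : Fin n → ℕ} → (∀ x → f x ≡ g x) → sumF f ≡ sumF g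
sumF-cong {zero}  e = refl
sumF-cong {suc n} e = cong₂ _+_ (e zero) (sumF-cong (e ∘ suc))

sumF-+ : (f g : Fin n → ℕ) → sumF f + sumF g ≡ sumF (λ x → f x + g x)
sumF-+ {zero}  f g = refl
sumF-+ {suc n} f g = begin
  f zero + Σf + (g zero + Σg)   ≡⟨ regroup (f zero) Σf (g zero) Σg ⟩
  f zero + g zero + (Σf + Σg)   ≡⟨ cong (f zero + g zero +_) (sumF-+ (f ∘ suc) (g ∘ suc)) ⟩
  sumF (λ x → f x + g x)      ∎
  where
  open ≡-Reasoning
  Σf = sumF (f ∘ suc)
  Σg = sumF (g ∘ suc)
  regroup : ∀ a b c d → a + b + (c + d) ≡ a + c + (b + d)
  regroup = solve-∀

-- Each side carries the other function's value at `x`, so that no truncated subtraction enters.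
sumF-replace : (f g : Fin n → ℕ) (x : Fin n) → (∀ y → y ≢ x → f y ≡ g y) →
  sumF f + g x ≡ sumF g + f x
sumF-replace f g zero    e = begin
  f zero + sumF (f ∘ suc) + g zero  ≡⟨ cong (λ s → f zero + s + g zero) (sumF-cong λ y → e (suc y) λ ()) ⟩
  f zero + sumF (g ∘ suc) + g zero  ≡⟨ regroup (f zero) _ (g zero) ⟩
  g zero + sumF (g ∘ suc) + f zero  ∎
  where
  open ≡-Reasoning
  regroup : ∀ a b c → a + b + c ≡ c + b + a
  regroup = solve-∀
sumF-replace f g (suc x) e = begin
  f zero + sumF (f ∘ suc) + g (suc x)    ≡⟨ +-assoc (f zero) _ _ ⟩
  f zero + (sumF (f ∘ suc) + g (suc x))
    ≡⟨ cong₂ _+_ (e zero λ ()) (sumF-replace (f ∘ suc) (g ∘ suc) x λ y y≢x → e (suc y) (y≢x ∘ Fin.suc-injective)) ⟩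
  g zero + (sumF (g ∘ suc) + f (suc x))  ≡⟨ +-assoc (g zero) _ _ ⟨
  g zero + sumF (g ∘ suc) + f (suc x)    ∎
  where open ≡-Reasoning

-- Set f to 0 at the head of the list: the rest of the list does not meet the head and keeps its
-- sum, while the full sum drops by f x.
sum-unique : (f : Fin n → ℕ) {xs : List (Fin n)} → Unique xs → sum (map f xs) ≤ sumF f
sum-unique f []                      = z≤n
sum-unique {n} f {x ∷ xs} (x∉xs ∷ u) = begin
  f x + sum (map f xs)   ≡⟨ cong (f x +_) (agree x∉xs) ⟩
  f x + sum (map f′ xs)  ≤⟨ +-monoʳ-≤ (f x) (sum-unique f′ u) ⟩
  f x + sumF f′          ≡⟨ +-comm (f x) (sumF f′) ⟩
  sumF f′ + f x          ≡⟨ sumF-replace f f′ x (λ y y≢x → sym (f′-off y y≢x)) ⟨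
  sumF f + f′ x          ≡⟨ cong (sumF f +_) f′-at ⟩
  sumF f + 0             ≡⟨ +-identityʳ _ ⟩
  sumF f                 ∎
  where
  open ≤-Reasoning
  f′ : Fin n → ℕ
  f′ y = choose (does (y Fin.≟ x)) 0 (f y)
  f′-at : f′ x ≡ 0
  f′-at with x Fin.≟ x
  ... | yes _   = refl
  ... | no x≢x = contradiction refl x≢x
  f′-off : ∀ y → y ≢ x → f′ y ≡ f y
  f′-off y y≢x with y Fin.≟ x
  ... | yes y≡x = contradiction y≡x y≢x
  ... | no _    = refl
  agree : ∀ {ys} → All (x ≢_) ys → sum (map f ys) ≡ sum (map f′ ys)
  agree []         = refl
  agree {y ∷ _} (x≢y ∷ a) = cong₂ _+_ (sym (f′-off y (x≢y ∘ sym))) (agree a)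

-- The auction for the small sets

∈⇒0<∣∣ : {p : Subset n} {x : Fin n} → x ∈ p → 0 < ∣ p ∣
∈⇒0<∣∣ x∈p = ≤-<-trans z≤n (x∈p⇒∣p-x∣<∣p∣ x∈p)

module Auction (L : ℕ) {u : ℕ} (𝒮 : List (Subset u)) where
  private q = suc L
  open Algorithm q L
  open Pay L

  State : Set
  State = List (Subset u) × Vec (Entry u) u

  record Owned (tb : Vec (Entry u) u) (x : Fin u) : Set where
    field
      owner∈𝒮     : owner tb x List.∈ 𝒮
      owner-small : ∣ owner tb x ∣ < q
      share⊆owner : share tb x ⊆ owner tb x
      ∣share∣     : ∣ share tb x ∣ ≡ 1
      x∈share     : x ∈ share tb x
      -- Complementary slackness up to 1: x was a cheapest element when it was bought, its price
      -- then rose by 1, and the other prices can only grow.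
      cheapest    : ∀ y → y ∈ owner tb x → price tb x ≤ suc (price tb y)

  record Inv (wl : List (Subset u)) (tb : Vec (Entry u) u) : Set where
    field
      wl-sound  : ∀ {S} → S List.∈ wl → S List.∈ 𝒮 × ∣ S ∣ < q
      wl-unique : Unique wl
      price≤L   : ∀ x → price tb x ≤ L
      owned     : ∀ x → price tb x ≢ 0 → Owned tb x
      owner∉wl  : ∀ x → price tb x ≢ 0 → ¬ owner tb x List.∈ wl
      injective : ∀ x y → price tb x ≢ 0 → price tb y ≢ 0 → owner tb x ≡ owner tb y → x ≡ y
      -- For an empty worklist this leaves two cases, served or priced out, on which the duality
      -- argument rests.
      complete  : ∀ {S} → S List.∈ 𝒮 → ∣ S ∣ < q → Nonempty S →
                  S List.∈ wl ⊎ (∃ λ x → price tb x ≢ 0 × owner tb x ≡ S) ⊎ (∀ y → y ∈ S → L ≤ price tb y)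

  slack : Vec (Entry u) u → ℕ
  slack tb = sumF λ x → L ∸ price tb x

  -- A potential that every bid lowers: either a set leaves the worklist for good, or a price rises
  -- by 1 and at most one evicted set takes the bidder's place.
  measure : State → ℕ
  measure (wl , tb) = length wl + slack tb

  module Step (S : Subset u) (wl : List (Subset u)) (tb : Vec (Entry u) u) (inv : Inv (S ∷ wl) tb) where
    open Inv inv

    S∈𝒮 : S List.∈ 𝒮
    S∈𝒮 = proj₁ (wl-sound (here refl))

    S-small : ∣ S ∣ < q
    S-small = proj₂ (wl-sound (here refl))

    S∉wl : ¬ S List.∈ wl
    S∉wl S∈wl with wl-unique
    ... | S≢ ∷ _ = All.lookup S≢ S∈wl refl

    -- The premise is conditional because an empty set is dropped as well: its mark succeeds with no
    -- element, whatever the prices are.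
    drop : (Nonempty S → ∀ y → y ∈ S → L ≤ price tb y) → Inv wl tb
    drop unaffordable = record
      { wl-sound  = wl-sound ∘ there
      ; wl-unique = case wl-unique of λ { (_ ∷ un) → un }
      ; price≤L   = price≤L
      ; owned     = owned
      ; owner∉wl  = λ x p≢0 → owner∉wl x p≢0 ∘ there
      ; injective = injective
      ; complete  = λ S∈𝒮 small ne → case complete S∈𝒮 small ne of λ where
          (inj₁ (here refl))  → inj₂ (inj₂ (unaffordable ne))
          (inj₁ (there S∈wl)) → inj₁ S∈wl
          (inj₂ r)            → inj₂ r
      }

    module _ (x : Fin u) (x∈S : x ∈ S) (min : ∀ y → y ∈ S → price tb x ≤ price tb y)
             (p<L : price tb x < L) where

      wl′ : List (Subset u)
      wl′ = evict (lookup tb x) wl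

      tb′ : Vec (Entry u) u
      tb′ = tb [ x ]≔ (suc (price tb x) , S , ⁅ x ⁆)

      at : lookup tb′ x ≡ (suc (price tb x) , S , ⁅ x ⁆)
      at = lookup∘update x tb _

      off : ∀ {y} → y ≢ x → lookup tb′ y ≡ lookup tb y
      off y≢x = lookup∘update′ y≢x tb _

      price-mono : ∀ y → price tb y ≤ price tb′ y
      price-mono y with y Fin.≟ x
      ... | yes refl = ≤-trans (n≤1+n _) (≤-reflexive (sym (cong proj₁ at)))
      ... | no y≢x   = ≤-reflexive (sym (cong proj₁ (off y≢x)))

      wl′⁻ : ∀ {T} → T List.∈ wl′ → T List.∈ wl ⊎ (price tb x ≢ 0 × T ≡ owner tb x)
      wl′⁻ T∈ with price tb x
      wl′⁻ T∈          | zero  = inj₁ T∈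
      wl′⁻ (here refl) | suc _ = inj₂ ((λ ()) , refl)
      wl′⁻ (there T∈)  | suc _ = inj₁ T∈

      wl⊆wl′ : ∀ {T} → T List.∈ wl → T List.∈ wl′
      wl⊆wl′ T∈ with price tb x
      ... | zero  = T∈
      ... | suc _ = there T∈

      evicted : price tb x ≢ 0 → owner tb x List.∈ wl′
      evicted p≢0 with price tb x
      ... | zero  = contradiction refl p≢0
      ... | suc _ = here refl

      wl′-unique : Unique wl′
      wl′-unique with price tb x in eq | wl-unique
      ... | zero  | _ ∷ un = un
      ... | suc _ | _ ∷ un =
        All.tabulate (λ { T∈ refl → owner∉wl x (λ z → case trans (sym eq) z of λ ()) (there T∈) }) ∷ un

      take : Inv wl′ tb′
      take = record
        { wl-sound  = λ T∈ → case wl′⁻ T∈ of λ where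
            (inj₁ T∈wl)         → wl-sound (there T∈wl)
            (inj₂ (p≢0 , refl)) → Owned.owner∈𝒮 (owned x p≢0) , Owned.owner-small (owned x p≢0)
        ; wl-unique = wl′-unique
        ; price≤L   = price≤L′
        ; owned     = owned′
        ; owner∉wl  = owner∉wl′
        ; injective = injective′
        ; complete  = λ T∈𝒮 small ne → case complete T∈𝒮 small ne of λ where
            (inj₁ (here refl))           → inj₂ (inj₁ (x , price-x , cong (proj₁ ∘ proj₂) at))
            (inj₁ (there T∈wl))          → inj₁ (wl⊆wl′ T∈wl)
            (inj₂ (inj₁ (y , p , refl))) → still y p
            (inj₂ (inj₂ r))              → inj₂ (inj₂ λ y y∈ → ≤-trans (r y y∈) (price-mono y))
        }
        where
        price-x : price tb′ x ≢ 0
        price-x z = case trans (sym (cong proj₁ at)) z of λ ()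

        still : ∀ y → price tb y ≢ 0 →
          owner tb y List.∈ wl′ ⊎ (∃ λ z → price tb′ z ≢ 0 × owner tb′ z ≡ owner tb y) ⊎
          (∀ z → z ∈ owner tb y → L ≤ price tb′ z)
        still y p with y Fin.≟ x
        ... | yes refl = inj₁ (evicted p)
        ... | no y≢x   = inj₂ (inj₁ (y , subst (λ e → proj₁ e ≢ 0) (sym (off y≢x)) p ,
                                     cong (proj₁ ∘ proj₂) (off y≢x)))

        price≤L′ : ∀ y → price tb′ y ≤ L
        price≤L′ y with y Fin.≟ x
        ... | yes refl = ≤-trans (≤-reflexive (cong proj₁ at)) p<L
        ... | no y≢x   = ≤-trans (≤-reflexive (cong proj₁ (off y≢x))) (price≤L y)

        owned′ : ∀ y → price tb′ y ≢ 0 → Owned tb′ y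
        owned′ y p with y Fin.≟ x
        ... | yes refl = record
          { owner∈𝒮     = subst (List._∈ 𝒮) (sym o≡) S∈𝒮
          ; owner-small = subst (λ T → ∣ T ∣ < q) (sym o≡) S-small
          ; share⊆owner = subst₂ _⊆_ (sym s≡) (sym o≡) (λ z∈ → subst (_∈ S) (sym (x∈⁅y⁆⇒x≡y x z∈)) x∈S)
          ; ∣share∣     = trans (cong ∣_∣ s≡) (∣⁅x⁆∣≡1 x)
          ; x∈share     = subst (x ∈_) (sym s≡) (x∈⁅x⁆ x)
          ; cheapest    = λ z z∈ → subst (_≤ suc (price tb′ z)) (sym (cong proj₁ at))
              (s≤s (≤-trans (min z (subst (z ∈_) o≡ z∈)) (price-mono z)))
          }
          where
          o≡ : owner tb′ x ≡ S
          o≡ = cong (proj₁ ∘ proj₂) at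
          s≡ : share tb′ x ≡ ⁅ x ⁆
          s≡ = cong (proj₂ ∘ proj₂) at
        ... | no y≢x = record
          { owner∈𝒮     = subst (List._∈ 𝒮) (sym o≡) owner∈𝒮
          ; owner-small = subst (λ T → ∣ T ∣ < q) (sym o≡) owner-small
          ; share⊆owner = subst₂ _⊆_ (sym s≡) (sym o≡) share⊆owner
          ; ∣share∣     = trans (cong ∣_∣ s≡) ∣share∣
          ; x∈share     = subst (y ∈_) (sym s≡) x∈share
          ; cheapest    = λ z z∈ → subst (_≤ suc (price tb′ z)) (sym (cong proj₁ (off y≢x)))
              (≤-trans (cheapest z (subst (z ∈_) o≡ z∈)) (s≤s (price-mono z)))
          }
          where
          open Owned (owned y (subst (λ e → proj₁ e ≢ 0) (off y≢x) p))
          o≡ : owner tb′ y ≡ owner tb y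
          o≡ = cong (proj₁ ∘ proj₂) (off y≢x)
          s≡ : share tb′ y ≡ share tb y
          s≡ = cong (proj₂ ∘ proj₂) (off y≢x)

        owner≢S : ∀ y → price tb y ≢ 0 → owner tb y ≢ S
        owner≢S y p refl = owner∉wl y p (here refl)

        S∉wl′ : ¬ S List.∈ wl′
        S∉wl′ S∈ with wl′⁻ S∈
        ... | inj₁ S∈wl       = S∉wl S∈wl
        ... | inj₂ (p≢0 , e) = owner≢S x p≢0 (sym e)

        owner∉wl′ : ∀ y → price tb′ y ≢ 0 → ¬ owner tb′ y List.∈ wl′
        owner∉wl′ y p o∈ with y Fin.≟ x
        ... | yes refl = S∉wl′ (subst (λ e → proj₁ (proj₂ e) List.∈ wl′) at o∈)
        ... | no y≢x rewrite off y≢x with wl′⁻ o∈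
        ...   | inj₁ o∈wl      = owner∉wl y p (there o∈wl)
        ...   | inj₂ (p≢0 , e) = y≢x (injective y x p p≢0 e)

        injective′ : ∀ y z → price tb′ y ≢ 0 → price tb′ z ≢ 0 → owner tb′ y ≡ owner tb′ z → y ≡ z
        injective′ y z py pz e with y Fin.≟ x | z Fin.≟ x
        ... | yes refl | yes refl = refl
        ... | yes refl | no z≢x rewrite off z≢x =
          ⊥-elim (owner≢S z pz (trans (sym e) (cong (proj₁ ∘ proj₂) at)))
        ... | no y≢x | yes refl rewrite off y≢x =
          ⊥-elim (owner≢S y py (trans e (cong (proj₁ ∘ proj₂) at)))
        ... | no y≢x | no z≢x rewrite off y≢x | off z≢x = injective y z py pz e

      take-measure : length wl′ + slack tb′ ≤ length wl + slack tb
      take-measure = begin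
        length wl′ + slack tb′       ≤⟨ +-monoˡ-≤ (slack tb′) length-wl′ ⟩
        suc (length wl) + slack tb′  ≡⟨ +-suc (length wl) (slack tb′) ⟨
        length wl + suc (slack tb′)  ≡⟨ cong (length wl +_) slack-drops ⟨
        length wl + slack tb         ∎
        where
        open ≤-Reasoning
        length-wl′ : length wl′ ≤ suc (length wl)
        length-wl′ with price tb x
        ... | zero  = n≤1+n _
        ... | suc _ = ≤-refl
        slack-drops : slack tb ≡ suc (slack tb′)
        slack-drops = +-cancelʳ-≡ (L ∸ suc (price tb x)) _ _ (begin-equality
          slack tb + (L ∸ suc (price tb x))
            ≡⟨ cong (λ e → slack tb + (L ∸ proj₁ e)) at ⟨
          slack tb + (L ∸ price tb′ x)
            ≡⟨ sumF-replace _ _ x (λ y y≢x → cong (λ e → L ∸ proj₁ e) (sym (off y≢x))) ⟩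
          slack tb′ + (L ∸ price tb x)
            ≡⟨ cong (slack tb′ +_) (+-∸-assoc 1 p<L) ⟩
          slack tb′ + suc (L ∸ suc (price tb x))
            ≡⟨ +-suc (slack tb′) _ ⟩
          suc (slack tb′) + (L ∸ suc (price tb x)) ∎)

    Good : State → Set
    Good st = Inv (proj₁ st) (proj₂ st) × measure st ≤ length wl + slack tb

    -- Failure at level l shows that all prices in S exceed l: a single candidate would pay q > |S|.
    -- So the lower bound rises with the level, and at L the set may be dropped. Success takes at
    -- most one element since q |M| < |S| + q < 2q.
    bid-good : ∀ r l → l + r ≡ L → (∀ y → y ∈ S → l ≤ price tb y) → Good (bid r l S (wl , tb))
    bid-good zero    l e low =
      drop (λ _ y y∈S → subst (_≤ price tb y) (trans (sym (+-identityʳ l)) e) (low y y∈S)) , ≤-refl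
    bid-good (suc r) l e low = resolve (mark l S tb) (pay-result _ _) (pay-⊆ (sizeOf S) (candidates l S tb))
      where
      resolve : ∀ m → PayResult (sizeOf S) (candidates l S tb) m → proj₂ m ⊆ candidates l S tb →
        Good (choose (isZero (proj₁ m)) (update S (proj₂ m) (proj₂ m) wl tb) (bid r (suc l) S (wl , tb)))
      resolve (_ , M) (paid p₁ p₂) M⊆c with ∣ M ∣ in ∣M∣
      ... | zero rewrite ∣p∣≡0⇒p≡∅ M ∣M∣ | update-∅ S ∅ wl tb =
        drop (λ { (_ , z∈S) → contradiction (∈⇒0<∣∣ z∈S) (≤⇒≯ ∣S∣≤0) }) , ≤-refl
        where
        ∣S∣≤0 : ∣ S ∣ ≤ 0
        ∣S∣≤0 = ≤-trans (≤-reflexive (sym (sizeOf-∣∣ S))) (≤-trans p₁ (≤-reflexive (*-zeroʳ q)))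
      ... | suc (suc k) = contradiction p₂ (≤⇒≯ (begin
        sizeOf S + q          ≤⟨ +-monoˡ-≤ q (≤-trans (≤-reflexive (sizeOf-∣∣ S)) (<⇒≤ S-small)) ⟩
        q + q                 ≤⟨ +-monoʳ-≤ q (m≤m+n q (q * k)) ⟩
        q + (q + q * k)       ≡⟨ cong (q +_) (*-suc q k) ⟨
        q + q * suc k         ≡⟨ *-suc q (suc k) ⟨
        q * suc (suc k)       ∎))
        where open ≤-Reasoning
      ... | suc zero with ∣p∣≡1⇒p≡⁅x⁆ M ∣M∣
      ...   | x , refl rewrite update-⁅⁆ S ⁅ x ⁆ x wl tb = take x x∈S min p<L , take-measure x x∈S min p<L
        where
        x∈c = candidates⁻ l S tb (M⊆c (x∈⁅x⁆ x))
        x∈S = proj₁ x∈c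
        min : ∀ y → y ∈ S → price tb x ≤ price tb y
        min y y∈S = ≤-trans (proj₂ x∈c) (low y y∈S)
        p<L : price tb x < L
        p<L = ≤-<-trans (proj₂ x∈c) (<-≤-trans (m<m+n l (s≤s z≤n)) (≤-reflexive e))
      resolve (_ , M) (short {r′} p₁ p₂) M⊆c = bid-good r (suc l) (trans (sym (+-suc l r)) e) low′
        where
        open ≤-Reasoning
        low′ : ∀ y → y ∈ S → suc l ≤ price tb y
        low′ y y∈S = ≰⇒> λ p≤l → <⇒≱ S-small (begin
          q                        ≡⟨ *-identityʳ q ⟨
          q * 1                    ≤⟨ *-monoʳ-≤ q (∈⇒0<∣∣ (candidates⁺ l S tb y∈S p≤l)) ⟩
          q * ∣ candidates l S tb ∣ ≡⟨ cong (q *_) p₂ ⟨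
          q * ∣ M ∣                ≤⟨ m≤n+m _ (suc r′) ⟩
          suc r′ + q * ∣ M ∣       ≡⟨ p₁ ⟨
          sizeOf S                 ≡⟨ sizeOf-∣∣ S ⟩
          ∣ S ∣                    ∎)

  -- An empty worklist is a fixed point of `auctionStep`; the disjunction therefore survives the
  -- steps left over after early termination.
  Within : ℕ → State → Set
  Within k st = Inv (proj₁ st) (proj₂ st) × (proj₁ st ≡ [] ⊎ measure st ≤ k)

  step-within : ∀ {k} st → Within (suc k) st → Within k (auctionStep st)
  step-within ([] , tb)     (inv , _)      = inv , inj₁ refl
  step-within (S ∷ wl , tb) (inv , inj₂ m) =
    let inv′ , m′ = Step.bid-good S wl tb inv L 0 refl (λ _ _ → z≤n)
    in inv′ , inj₂ (≤-trans m′ (≤-pred m))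

  repeat-within : ∀ k {j} (f : State → State) {i} → (∀ {j} st → Within (i + j) st → Within j (f st)) →
    ∀ st → Within (k * i + j) st → Within j (repeat f k st)
  repeat-within zero    f d st w = w
  repeat-within (suc k) {j} f {i} d st w =
    d _ (repeat-within k f d st (subst (λ m → Within m st) (regroup i (k * i) j) w))
    where
    regroup : ∀ a b c → a + b + c ≡ b + (a + c)
    regroup = solve-∀

  smallSets-filter : smallSets (Vec.fromList 𝒮) ≡ filter (λ S → ∣ S ∣ <? q) 𝒮
  smallSets-filter = trans (foldVec-fromList _ [] 𝒮) (go 𝒮)
    where
    go : ∀ xs → List.foldr (λ S w → choose (isZero (suc (sizeOf S) ∸ q)) (S ∷ w) w) [] xs ≡
         filter (λ S → ∣ S ∣ <? q) xs
    go []       = refl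
    go (S ∷ xs) with ∣ S ∣ <? q
    ... | yes s<q rewrite sizeOf-∣∣ S | m≤n⇒m∸n≡0 (≤-pred s<q) =
      trans (cong (S ∷_) (go xs)) (sym (filter-accept (λ S → ∣ S ∣ <? q) {S} {xs} s<q))
    ... | no s≮q rewrite sizeOf-∣∣ S with ∣ S ∣ ∸ L in d
    ...   | zero  = contradiction (s≤s (m∸n≡0⇒m≤n d)) s≮q
    ...   | suc _ = trans (go xs) (sym (filter-reject (λ S → ∣ S ∣ <? q) {S} {xs} s≮q))

  price-empty : ∀ x → price (emptyTable u) x ≡ 0
  price-empty x = cong proj₁ (lookup-replicate x _)

  sumF-const : ∀ {n} k → sumF {n} (λ _ → k) ≡ n * k
  sumF-const {zero}  k = refl
  sumF-const {suc n} k = cong (k +_) (sumF-const {n} k)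

  initially-within : Unique 𝒮 → Within (length 𝒮 + u * L) (smallSets (Vec.fromList 𝒮) , emptyTable u)
  initially-within unique rewrite smallSets-filter = record
    { wl-sound  = ∈-filter⁻ (λ S → ∣ S ∣ <? q)
    ; wl-unique = Unique.filter⁺ (λ S → ∣ S ∣ <? q) unique
    ; price≤L   = λ x → subst (_≤ L) (sym (price-empty x)) z≤n
    ; owned     = λ x p → contradiction (price-empty x) p
    ; owner∉wl  = λ x p → contradiction (price-empty x) p
    ; injective = λ x y p → contradiction (price-empty x) p
    ; complete  = λ S∈ small _ → inj₁ (∈-filter⁺ (λ S → ∣ S ∣ <? q) S∈ small)
    } , inj₂ (+-mono-≤ (length-filter (λ S → ∣ S ∣ <? q) 𝒮)
          (≤-reflexive (trans (sumF-cong λ x → cong (L ∸_) (price-empty x)) (sumF-const {u} L))))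

  prices : Vec (Entry u) u
  prices = proj₂ (auction (Vec.fromList 𝒮))

  finally : Unique 𝒮 → Inv [] prices
  finally unique with auction (Vec.fromList 𝒮) | terminated
    where
    start : State
    start = smallSets (Vec.fromList 𝒮) , emptyTable u

    terminated : Within 0 (auction (Vec.fromList 𝒮))
    terminated = repeat-within L (repeat auctionStep u)
      (λ {j} st w → repeat-within u auctionStep step-within st
        (subst (λ k → Within (k + j) st) (sym (*-identityʳ u)) w)) _
      (repeat-within (length 𝒮) auctionStep step-within start
        (subst (λ k → Within k start) (cong₂ _+_ (sym (*-identityʳ (length 𝒮)))
          (trans (*-comm u L) (sym (+-identityʳ _))))
          (initially-within unique)))
  ... | [] , tb    | inv , _       = inv
  ... | _ ∷ _ , tb | _ , inj₁ ()
  ... | _ ∷ _ , tb | _ , inj₂ ()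

  -- Linear programming duality: the prices, with the profits 1 - price / L
  -- of the served sets, form a fractional cover of the small sets P j.
  module Duality {m : ℕ} (P : Fin m → Subset u) (P∈𝒮 : ∀ j → P j List.∈ 𝒮)
                 (nonempty : ∀ j → Nonempty (P j))
                 (disjoint : ∀ {i j x} → x ∈ P i → x ∈ P j → i ≡ j)
                 (tb : Vec (Entry u) u) (inv : Inv [] tb) where
    open Inv inv

    rep : Fin m → Fin u
    rep j = proj₁ (nonempty j)

    rep-injective : ∀ {i j} → rep i ≡ rep j → i ≡ j
    rep-injective {i} {j} e = disjoint (proj₂ (nonempty i)) (subst (_∈ P j) (sym e) (proj₂ (nonempty j)))

    P-injective : ∀ {i j} → P i ≡ P j → i ≡ j
    P-injective {i} {j} e = disjoint (proj₂ (nonempty i)) (subst (rep i ∈_) e (proj₂ (nonempty i)))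

    -- Scaled by L, with one extra unit that absorbs the slack 1 in `cheapest`. Price and profit
    -- then add up to q = L + 1 at each owned element and to 0 elsewhere; this unit is the loss
    -- factor L / (L + 1).
    profit : Fin u → ℕ
    profit x = choose (isZero (price tb x)) 0 (q ∸ price tb x)

    Served : List (Fin m) → Fin u → Set
    Served js y = ∃ λ j → j List.∈ js × price tb y ≢ 0 × owner tb y ≡ P j

    -- A priced-out P j is paid by `rep j` alone. A served one owns some y with price at most one
    -- above that of `rep j`, and the profit of y makes up the rest. No profit is spent twice, as y
    -- has one owner and P is injective.
    cover : ∀ {js} → Unique js → All (λ j → ∣ P j ∣ < q) js →
      ∃ λ ys → Unique ys × All (Served js) ys ×
        length js * L ≤ sum (map (price tb) (map rep js)) + sum (map profit ys)
    cover {[]} [] [] = [] , [] , [] , z≤n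
    cover {j ∷ js} (j∉js ∷ unique) (small ∷ smalls) with cover unique smalls
    ... | ys , unique-ys , served , bound with complete (P∈𝒮 j) small (nonempty j)
    ... | inj₂ (inj₂ dear) =
      ys , unique-ys , All.map (λ { (i , i∈ , r) → i , there i∈ , r }) served ,
      ≤-trans (+-mono-≤ (dear (rep j) (proj₂ (nonempty j))) bound) (≤-reflexive (sym (+-assoc (price tb (rep j)) _ _)))
    ... | inj₂ (inj₁ (y , p≢0 , own)) =
      y ∷ ys , All.map fresh served ∷ unique-ys ,
      (j , here refl , p≢0 , own) ∷ All.map (λ { (i , i∈ , r) → i , there i∈ , r }) served ,
      ≤-trans (+-mono-≤ paid-for bound) (≤-reflexive (regroup (price tb (rep j)) _ _ _))
      where
      fresh : ∀ {z} → Served js z → y ≢ z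
      fresh (i , i∈ , _ , own′) refl = All.lookup j∉js i∈ (P-injective (trans (sym own) own′))
      profit-y : profit y ≡ q ∸ price tb y
      profit-y with price tb y
      ... | zero  = contradiction refl p≢0
      ... | suc _ = refl
      paid-for : L ≤ price tb (rep j) + profit y
      paid-for = ≤-pred (begin
        q                                            ≡⟨ m∸n+n≡m (m≤n⇒m≤1+n (price≤L y)) ⟨
        q ∸ price tb y + price tb y                  ≤⟨ +-monoʳ-≤ (q ∸ price tb y)
          (Owned.cheapest (owned y p≢0) (rep j) (subst (rep j ∈_) (sym own) (proj₂ (nonempty j)))) ⟩
        q ∸ price tb y + suc (price tb (rep j))      ≡⟨ +-comm (q ∸ price tb y) _ ⟩
        suc (price tb (rep j) + (q ∸ price tb y))    ≡⟨ cong (λ k → suc (price tb (rep j) + k)) profit-y ⟨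
        suc (price tb (rep j) + profit y)            ∎)
        where open ≤-Reasoning
      regroup : ∀ a b c d → a + b + (c + d) ≡ a + c + (b + d)
      regroup = solve-∀

    total : ∀ {n} (t : Vec (Entry u) n) → (∀ x → price t x ≤ q) →
      sumF (λ x → price t x + choose (isZero (price t x)) 0 (q ∸ price t x)) ≡ length (collect t) * q
    total []                 p≤q = refl
    total ((zero , _) ∷ t)  p≤q = total t (p≤q ∘ suc)
    total ((suc p , _) ∷ t) p≤q = cong₂ _+_ (m+[n∸m]≡n (p≤q zero)) (total t (p≤q ∘ suc))

    small-bound : ∀ {js} → Unique js → All (λ j → ∣ P j ∣ < q) js →
      length js * L ≤ length (collect tb) * q
    small-bound {js} unique small with cover unique small
    ... | ys , unique-ys , _ , bound = begin
      length js * L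
        ≤⟨ bound ⟩
      sum (map (price tb) (map rep js)) + sum (map profit ys)
        ≤⟨ +-mono-≤ (sum-unique (price tb) (Unique.map⁺ rep-injective unique)) (sum-unique profit unique-ys) ⟩
      sumF (price tb) + sumF profit
        ≡⟨ sumF-+ (price tb) profit ⟩
      sumF (λ x → price tb x + profit x)
        ≡⟨ total tb (λ x → m≤n⇒m≤1+n (price≤L x)) ⟩
      length (collect tb) * q ∎
      where open ≤-Reasoning

-- The greedy phase for the large sets

length-⊆ : {A : Set} {xs ys : List A} → Unique xs → (∀ {x} → x List.∈ xs → x List.∈ ys) → length xs ≤ length ys
length-⊆ []              sub = z≤n
length-⊆ {xs = x ∷ xs} (x∉xs ∷ u) sub with ∈-∃++ (sub (here refl))
... | as , bs , refl = ≤-trans (s≤s (length-⊆ u sub′))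
    (≤-reflexive (trans (cong suc (length-++ as)) (sym (trans (length-++ as) (+-suc (length as) (length bs))))))
  where
  sub′ : ∀ {y} → y List.∈ xs → y List.∈ as ++ bs
  sub′ y∈ with ∈-++⁻ as (sub (there y∈))
  ... | inj₁ y∈as         = ∈-++⁺ˡ y∈as
  ... | inj₂ (here refl)  = contradiction refl (All.lookup x∉xs y∈)
  ... | inj₂ (there y∈bs) = ∈-++⁺ʳ as y∈bs

∣∩∣+∣─∣ : (S C : Subset n) → ∣ S ∩ C ∣ + ∣ C ─ S ∣ ≡ ∣ C ∣
∣∩∣+∣─∣ []          []          = refl
∣∩∣+∣─∣ (true ∷ S)  (true ∷ C)  = cong suc (∣∩∣+∣─∣ S C)
∣∩∣+∣─∣ (true ∷ S)  (false ∷ C) = ∣∩∣+∣─∣ S C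
∣∩∣+∣─∣ (false ∷ S) (true ∷ C)  = trans (+-suc _ _) (cong suc (∣∩∣+∣─∣ S C))
∣∩∣+∣─∣ (false ∷ S) (false ∷ C) = ∣∩∣+∣─∣ S C

sum-mono : {A : Set} {f g : A → ℕ} (xs : List A) → (∀ {x} → x List.∈ xs → f x ≤ g x) →
  sum (map f xs) ≤ sum (map g xs)
sum-mono []       f≤g = z≤n
sum-mono (x ∷ xs) f≤g = +-mono-≤ (f≤g (here refl)) (sum-mono xs (f≤g ∘ there))

sum-* : {A : Set} (k : ℕ) (f : A → ℕ) (xs : List A) → sum (map (λ x → k * f x) xs) ≡ k * sum (map f xs)
sum-* k f []       = sym (*-zeroʳ k)
sum-* k f (x ∷ xs) = trans (cong (k * f x +_) (sum-* k f xs)) (sym (*-distribˡ-+ k (f x) _))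

inhabited : (p : Subset n) → 0 < ∣ p ∣ → Nonempty p
inhabited (true ∷ p)  _   = zero , here
inhabited (false ∷ p) 0<p = let x , x∈ = inhabited p 0<p in suc x , there x∈

module _ {m u : ℕ} (P : Fin m → Subset u) (disjoint : ∀ {i j x} → x ∈ P i → x ∈ P j → i ≡ j) where

  -- Removing P j from C costs |P j ∩ C| and is not noticed by the other sets, which are disjoint
  -- from P j.
  disjoint-overlap : ∀ {js} (C : Subset u) → Unique js → sum (map (λ j → ∣ P j ∩ C ∣) js) ≤ ∣ C ∣
  disjoint-overlap C [] = z≤n
  disjoint-overlap {j ∷ js} C (j∉js ∷ unique) = begin
    ∣ P j ∩ C ∣ + sum (map (λ i → ∣ P i ∩ C ∣) js)
      ≤⟨ +-monoʳ-≤ ∣ P j ∩ C ∣ (sum-mono js λ {i} i∈ → p⊆q⇒∣p∣≤∣q∣ (avoid i∈)) ⟩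
    ∣ P j ∩ C ∣ + sum (map (λ i → ∣ P i ∩ (C ─ P j) ∣) js)
      ≤⟨ +-monoʳ-≤ ∣ P j ∩ C ∣ (disjoint-overlap (C ─ P j) unique) ⟩
    ∣ P j ∩ C ∣ + ∣ C ─ P j ∣
      ≡⟨ ∣∩∣+∣─∣ (P j) C ⟩
    ∣ C ∣ ∎
    where
    open ≤-Reasoning
    avoid : ∀ {i} → i List.∈ js → P i ∩ C ⊆ P i ∩ (C ─ P j)
    avoid {i} i∈ x∈ with x∈p∩q⁻ (P i) C x∈
    ... | x∈P , x∈C = x∈p∩q⁺ (x∈P , x∈p∧x∉q⇒x∈p─q x∈C λ x∈Pj → All.lookup j∉js i∈ (disjoint x∈Pj x∈P))

module Greedy (L : ℕ) {u : ℕ} (𝒮 : List (Subset u)) (tb₀ : Vec (Entry u) u) (inv₀ : Auction.Inv L 𝒮 [] tb₀)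
              {m : ℕ} (P : Fin m → Subset u)
              (disjoint : ∀ {i j x} → x ∈ P i → x ∈ P j → i ≡ j) where
  private q = suc L
  open Algorithm q L
  open Pay L
  open Auction L 𝒮 using (Owned)

  k₁ : ℕ
  k₁ = length (collect tb₀)

  Valid : Subset u × Subset u → Set
  Valid (S , A) = S List.∈ 𝒮 × A ⊆ S × ∣ S ∣ ≤ q * ∣ A ∣

  Compatible : Subset u × Subset u → Subset u × Subset u → Set
  Compatible (S , A) (T , B) = S ≢ T × (∀ x → x ∈ A → x ∉ B)

  Taken : Vec (Entry u) u → Subset u × Subset u → Set
  Taken tb (_ , A) = ∀ x → x ∈ A → price tb x ≢ 0

  -- What a failed payment leaves: the free part F of S has q |F| ≤ |S|, hence the covered part has
  -- at least (q - 1)|S| / q elements. Phrased with `covered`, which only grows, the property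
  -- persists.
  Blocked : Vec (Entry u) u → Subset u → Set
  Blocked tb S = L * ∣ S ∣ ≤ q * ∣ S ∩ covered tb ∣

  Treated : ℕ → List (Subset u) → Subset u → Set
  Treated s T S = ∣ S ∣ < s ⊎ (∣ S ∣ ≡ s × S List.∈ T)

  -- The sets are treated in increasing order of size, T being those of the
  -- current size s that have been treated. Each blocked P j is charged to the
  -- elements it has in common with the shares given out so far; credit stands for
  -- q k₁ plus twice the sizes of the new sets. balance is the summation by parts
  -- of the inequalities weight-bound for all sizes up to s.
  record Progress (s : ℕ) (T : List (Subset u)) (out : List (Subset u × Subset u))
                  (tb : Vec (Entry u) u) : Set where
    field
      new         : List (Subset u × Subset u)
      out≡        : out ≡ new ++ collect tb₀
      valid       : All Valid out
      compatible  : AllPairs Compatible out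
      taken       : All (Taken tb) out
      treated     : All (λ e → Treated s T (proj₁ e)) out
      lost        : List (Fin m)
      lost-unique : Unique lost
      lost-treated : All (λ j → Treated s T (P j)) lost
      blocked     : ∀ {j} → j List.∈ lost → Blocked tb (P j)
      complete    : ∀ j → q ≤ ∣ P j ∣ → Treated s T (P j) →
                    P j List.∈ map proj₁ new ⊎ j List.∈ lost
      credit      : ℕ
      charge      : q * ∣ covered tb ∣ ≤ credit
      balance     : s * (L * length lost) + credit ≤
                    s * (k₁ + 2 * length new) + L * sum (map (λ j → ∣ P j ∣) lost)

    weight-bound : L * sum (map (λ j → ∣ P j ∣) lost) ≤ credit
    weight-bound = begin
      L * sum (map (λ j → ∣ P j ∣) lost)                ≡⟨ sum-* L (λ j → ∣ P j ∣) lost ⟨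
      sum (map (λ j → L * ∣ P j ∣) lost)                ≤⟨ sum-mono lost blocked ⟩
      sum (map (λ j → q * ∣ P j ∩ covered tb ∣) lost)   ≡⟨ sum-* q (λ j → ∣ P j ∩ covered tb ∣) lost ⟩
      q * sum (map (λ j → ∣ P j ∩ covered tb ∣) lost)
        ≤⟨ *-monoʳ-≤ q (disjoint-overlap P disjoint (covered tb) lost-unique) ⟩
      q * ∣ covered tb ∣                                ≤⟨ charge ⟩
      credit                                                 ∎
      where open ≤-Reasoning

    -- `weight-bound` controls only the total size of the lost sets. Added to `balance` it cancels
    -- sizes and credit, leaving s times an inequality between numbers of sets.
    lost-bound : 0 < s → L * length lost ≤ k₁ + 2 * length new
    lost-bound (s≤s {n = s-1} _) = *-cancelˡ-≤ (suc s-1)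
      (+-cancelʳ-≤ credit _ _ (≤-trans balance (+-monoʳ-≤ _ weight-bound)))

  start : Progress q [] (collect tb₀) tb₀
  start = record
    { new          = []
    ; out≡         = refl
    ; valid        = collect-All tb₀ valid
    ; compatible   = collect-AllPairs tb₀ λ x y x≢y px py →
        (λ e → x≢y (injective x y px py e)) ,
        λ z z∈x z∈y → x≢y (trans (sym (only x px z∈x)) (only y py z∈y))
    ; taken        = collect-All tb₀ λ x p z z∈ → subst (λ w → price tb₀ w ≢ 0) (sym (only x p z∈)) p
    ; treated      = collect-All tb₀ λ x p → inj₁ (Owned.owner-small (owned x p))
    ; lost         = []
    ; lost-unique  = []
    ; lost-treated = []
    ; blocked      = λ ()
    ; complete     = λ { j q≤ (inj₁ <q) → contradiction <q (≤⇒≯ q≤) }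
    ; credit       = q * k₁
    ; charge       = ≤-reflexive (cong (q *_) (sym (length-collect tb₀)))
    ; balance      = ≤-reflexive (regroup q L k₁)
    }
    where
    open Auction.Inv inv₀
    valid : ∀ x → price tb₀ x ≢ 0 → Valid (proj₂ (lookup tb₀ x))
    valid x p = owner∈𝒮 , share⊆owner ,
      ≤-trans (<⇒≤ owner-small) (≤-reflexive (sym (trans (cong (q *_) ∣share∣) (*-identityʳ q))))
      where
      owned-x : Owned tb₀ x
      owned-x = owned x p
      open Owned owned-x
    only : ∀ x → price tb₀ x ≢ 0 → ∀ {z} → z ∈ share tb₀ x → z ≡ x
    only x p {z} z∈ with ∣p∣≡1⇒p≡⁅x⁆ (share tb₀ x) (Owned.∣share∣ (owned x p)) | Owned.x∈share (owned x p)
    ... | y , e | x∈ = trans (x∈⁅y⁆⇒x≡y y (subst (z ∈_) e z∈)) (sym (x∈⁅y⁆⇒x≡y y (subst (x ∈_) e x∈)))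
    regroup : ∀ q L k → q * (L * 0) + q * k ≡ q * (k + 0) + L * 0
    regroup = solve-∀

  treated-weaken : ∀ {s T S R} → Treated s T R → Treated s (S ∷ T) R
  treated-weaken (inj₁ lt)        = inj₁ lt
  treated-weaken (inj₂ (eq , R∈)) = inj₂ (eq , there R∈)

  module Step (S : Subset u) (S∈𝒮 : S List.∈ 𝒮) {s : ℕ} {T : List (Subset u)} (S∉T : ¬ S List.∈ T) (q≤s : q ≤ s)
              (out : List (Subset u × Subset u)) (tb : Vec (Entry u) u) (pr : Progress s T out tb) where
    open Progress pr

    untreated : ∣ S ∣ ≡ s → ∀ {R} → Treated s T R → S ≢ R
    untreated refl (inj₁ lt)       refl = <-irrefl refl lt
    untreated refl (inj₂ (_ , R∈)) refl = S∉T R∈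

    skip : ∣ S ∣ ≢ s → Progress s (S ∷ T) out tb
    skip ∣S∣≢s = record
      { Progress pr hiding (treated; lost-treated; complete)
      ; treated      = All.map treated-weaken treated
      ; lost-treated = All.map treated-weaken lost-treated
      ; complete     = λ where
          j q≤ (inj₁ lt)                 → complete j q≤ (inj₁ lt)
          j q≤ (inj₂ (eq , here refl))   → contradiction eq ∣S∣≢s
          j q≤ (inj₂ (eq , there P∈))    → complete j q≤ (inj₂ (eq , P∈))
      }

    lose : ∣ S ∣ ≡ s → Blocked tb S → Progress s (S ∷ T) out tb
    -- Only members of the hidden partition count as lost. This test belongs to the analysis; the
    -- algorithm does not know P.
    lose ∣S∣≡s blocked-S with Fin.any? (λ j → ≡-dec Bool._≟_ (P j) S)
    ... | no ∄j = record
      { Progress pr hiding (treated; lost-treated; complete)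
      ; treated      = All.map treated-weaken treated
      ; lost-treated = All.map treated-weaken lost-treated
      ; complete     = λ where
          j q≤ (inj₁ lt)                 → complete j q≤ (inj₁ lt)
          j q≤ (inj₂ (eq , here P≡S))    → contradiction (j , P≡S) ∄j
          j q≤ (inj₂ (eq , there P∈))    → complete j q≤ (inj₂ (eq , P∈))
      }
    ... | yes (i , refl) = record
      { Progress pr hiding (treated; lost; lost-unique; lost-treated; blocked; complete; balance)
      ; treated      = All.map treated-weaken treated
      ; lost         = i ∷ lost
      ; lost-unique  = All.map (λ { t refl → untreated ∣S∣≡s t refl }) lost-treated ∷ lost-unique
      ; lost-treated = inj₂ (∣S∣≡s , here refl) ∷ All.map treated-weaken lost-treated
      ; blocked      = λ { (here refl) → blocked-S ; (there j∈) → blocked j∈ }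
      ; complete     = λ where
          j q≤ (inj₁ lt)                 → Sum.map₂ there (complete j q≤ (inj₁ lt))
          j q≤ (inj₂ (eq , here P≡S))    → inj₂ (here (same P≡S q≤))
          j q≤ (inj₂ (eq , there P∈))    → Sum.map₂ there (complete j q≤ (inj₂ (eq , P∈)))
      ; balance      = balance′
      }
      where
      same : ∀ {j} → P j ≡ P i → q ≤ ∣ P j ∣ → j ≡ i
      same {j} e q≤ = let x , x∈ = inhabited (P j) (≤-trans (s≤s z≤n) q≤) in disjoint x∈ (subst (x ∈_) e x∈)
      balance′ : s * (L * suc (length lost)) + credit ≤
                 s * (k₁ + 2 * length new) + L * (∣ P i ∣ + sum (map (λ j → ∣ P j ∣) lost))
      balance′ rewrite ∣S∣≡s = begin
        s * (L * suc (length lost)) + credit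
          ≡⟨ lhs s L (length lost) credit ⟩
        s * (L * length lost) + credit + s * L
          ≤⟨ +-monoˡ-≤ (s * L) balance ⟩
        s * (k₁ + 2 * length new) + L * sum (map (λ j → ∣ P j ∣) lost) + s * L
          ≡⟨ rhs (s * (k₁ + 2 * length new)) s L _ ⟩
        s * (k₁ + 2 * length new) + L * (s + sum (map (λ j → ∣ P j ∣) lost)) ∎
        where
        open ≤-Reasoning
        lhs : ∀ s L g credit → s * (L * suc g) + credit ≡ s * (L * g) + credit + s * L
        lhs = solve-∀
        rhs : ∀ w s L t → w + L * t + s * L ≡ w + L * (s + t)
        rhs = solve-∀

    module _ (∣S∣≡s : ∣ S ∣ ≡ s) (M : Subset u) (M⊆ : M ⊆ candidates 0 S tb)
             (large : ∣ S ∣ ≤ q * ∣ M ∣) (tight : q * ∣ M ∣ < ∣ S ∣ + q) where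

      tb′ : Vec (Entry u) u
      tb′ = proj₂ (update S M M [] tb)

      price-mono : ∀ x → price tb x ≤ price tb′ x
      price-mono x rewrite price-update S M M [] tb x with lookup M x
      ... | true  = n≤1+n _
      ... | false = ≤-refl

      still-taken : ∀ {x} → price tb x ≢ 0 → price tb′ x ≢ 0
      still-taken {x} p p′ = p (n≤0⇒n≡0 (subst (price tb x ≤_) p′ (price-mono x)))

      newly-taken : ∀ {x} → x ∈ M → price tb′ x ≢ 0
      newly-taken {x} x∈M p′ = case trans (sym (price-update S M M [] tb x)) p′ of
        subst (λ b → choose b (suc (price tb x)) (price tb x) ≢ 0) (sym ([]=⇒lookup x∈M)) (λ ())

      covered-mono : covered tb ⊆ covered tb′
      covered-mono x∈ = covered⁺ tb′ (still-taken (covered⁻ tb x∈))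

      gain : Progress s (S ∷ T) ((S , M) ∷ out) tb′
      gain = record
        { new          = (S , M) ∷ new
        ; out≡         = cong ((S , M) ∷_) out≡
        ; valid        = (S∈𝒮 , (λ x∈ → proj₁ (candidates⁻ 0 S tb (M⊆ x∈))) , large) ∷ valid
        ; compatible   = All.zipWith
            (λ { (tr , tk) → untreated ∣S∣≡s tr ,
                 λ x x∈M x∈A → tk x x∈A (n≤0⇒n≡0 (proj₂ (candidates⁻ 0 S tb (M⊆ x∈M)))) })
            (treated , taken) ∷ compatible
        ; taken        = (λ x → newly-taken) ∷ All.map (λ tk x x∈ → still-taken (tk x x∈)) taken
        ; treated      = inj₂ (∣S∣≡s , here refl) ∷ All.map treated-weaken treated
        ; lost         = lost
        ; lost-unique  = lost-unique
        ; lost-treated = All.map treated-weaken lost-treated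
        ; blocked      = λ {j} j∈ → ≤-trans (blocked j∈) (*-monoʳ-≤ q (p⊆q⇒∣p∣≤∣q∣ λ x∈ →
            let x∈P , x∈c = x∈p∩q⁻ (P j) (covered tb) x∈ in x∈p∩q⁺ (x∈P , covered-mono x∈c)))
        ; complete     = λ where
            j q≤ (inj₁ lt)                 → Sum.map₁ there (complete j q≤ (inj₁ lt))
            j q≤ (inj₂ (eq , here P≡S))    → inj₁ (here P≡S)
            j q≤ (inj₂ (eq , there P∈))    → Sum.map₁ there (complete j q≤ (inj₂ (eq , P∈)))
        ; credit       = credit + (s + s)
        ; charge       = begin
            q * ∣ covered tb′ ∣             ≤⟨ *-monoʳ-≤ q (∣covered-update∣ S M M [] tb) ⟩
            q * (∣ covered tb ∣ + ∣ M ∣)    ≡⟨ *-distribˡ-+ q ∣ covered tb ∣ ∣ M ∣ ⟩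
            q * ∣ covered tb ∣ + q * ∣ M ∣  ≤⟨ +-mono-≤ charge (<⇒≤ tight) ⟩
            -- Rounding up costs less than q ≤ s. This is the source of the factor 2, and the place
            -- where the set has to be large.
            credit + (∣ S ∣ + q)                 ≤⟨ +-monoʳ-≤ credit (+-mono-≤ (≤-reflexive ∣S∣≡s) q≤s) ⟩
            credit + (s + s)                     ∎
        ; balance      = begin
            s * (L * length lost) + (credit + (s + s))
              ≡⟨ +-assoc (s * (L * length lost)) credit (s + s) ⟨
            s * (L * length lost) + credit + (s + s)
              ≤⟨ +-monoˡ-≤ (s + s) balance ⟩
            s * (k₁ + 2 * length new) + L * sum (map (λ j → ∣ P j ∣) lost) + (s + s)
              ≡⟨ regroup s k₁ (length new) _ ⟩
            s * (k₁ + 2 * suc (length new)) + L * sum (map (λ j → ∣ P j ∣) lost) ∎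
        }
        where
        open ≤-Reasoning
        regroup : ∀ s k h w → s * (k + 2 * h) + w + (s + s) ≡ s * (k + 2 * suc h) + w
        regroup = solve-∀

    step : let out′ , tb′ = greedyStep s S (out , tb) in Progress s (S ∷ T) out′ tb′
    step with hasSize s S in size
    ... | false = skip (hasSize-false s S size)
    ... | true  = resolve (mark 0 S tb) (pay-result _ _) (pay-⊆ (sizeOf S) (candidates 0 S tb))
      where
      ∣S∣≡s = hasSize-true s S size

      resolve : ∀ m → PayResult (sizeOf S) (candidates 0 S tb) m → proj₂ m ⊆ candidates 0 S tb →
        let st = choose (isZero (proj₁ m))
                   ((S , proj₂ m) ∷ out , proj₂ (update S (proj₂ m) (proj₂ m) [] tb)) (out , tb)
        in Progress s (S ∷ T) (proj₁ st) (proj₂ st)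
      resolve (_ , M) (paid p₁ p₂) M⊆ rewrite sizeOf-∣∣ S = gain ∣S∣≡s M M⊆ p₁ p₂
      resolve (_ , M) (short {r′} p₁ p₂) M⊆ =
        lose ∣S∣≡s (+-cancelˡ-≤ (∣ S ∣) _ _ (begin
          q * ∣ S ∣                                      ≡⟨ cong (q *_) (∣candidates∣+∣covered∣ S tb) ⟨
          q * (∣ candidates 0 S tb ∣ + ∣ S ∩ covered tb ∣)   ≡⟨ *-distribˡ-+ q ∣ candidates 0 S tb ∣ _ ⟩
          q * ∣ candidates 0 S tb ∣ + q * ∣ S ∩ covered tb ∣ ≤⟨ +-monoˡ-≤ _ few ⟩
          ∣ S ∣ + q * ∣ S ∩ covered tb ∣                 ∎))
        where
        open ≤-Reasoning
        few : q * ∣ candidates 0 S tb ∣ ≤ ∣ S ∣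
        few = begin
          q * ∣ candidates 0 S tb ∣  ≡⟨ cong (q *_) p₂ ⟨
          q * ∣ M ∣                  ≤⟨ m≤n+m _ (suc r′) ⟩
          suc r′ + q * ∣ M ∣         ≡⟨ p₁ ⟨
          sizeOf S                   ≡⟨ sizeOf-∣∣ S ⟩
          ∣ S ∣                      ∎

  round : ∀ {s} → q ≤ s → ∀ xs → Unique xs → (∀ {S} → S List.∈ xs → S List.∈ 𝒮) →
    ∀ {st} → Progress s [] (proj₁ st) (proj₂ st) →
    let st′ = List.foldr (greedyStep s) st xs in Progress s xs (proj₁ st′) (proj₂ st′)
  round q≤s []       _                sub pr = pr
  round q≤s (S ∷ xs) (S∉xs ∷ unique) sub pr =
    Step.step S (sub (here refl)) (λ S∈ → All.lookup S∉xs S∈ refl) q≤s _ _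
      (round q≤s xs unique (sub ∘ there) pr)

  next-size : ∀ {s out tb} → 0 < s → (∀ j → P j List.∈ 𝒮) → Progress s 𝒮 out tb → Progress (suc s) [] out tb
  next-size {s} {out} {tb} 0<s P∈𝒮 pr = record
    { Progress pr hiding (treated; lost-treated; complete; balance)
    ; treated      = All.map grow treated
    ; lost-treated = All.map grow lost-treated
    ; complete     = λ { j q≤ (inj₁ lt) → complete j q≤ (shrink j lt) }
    ; balance      = begin
        L * length lost + s * (L * length lost) + credit
          ≡⟨ +-assoc (L * length lost) _ credit ⟩
        L * length lost + (s * (L * length lost) + credit)
          -- Raising s by 1 adds the bound valid at size s to both sides; the repetition over all
          -- sizes is the summation by parts.
          ≤⟨ +-mono-≤ (lost-bound 0<s) balance ⟩
        k₁ + 2 * length new + (s * (k₁ + 2 * length new) + L * sum (map (λ j → ∣ P j ∣) lost))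
          ≡⟨ +-assoc (k₁ + 2 * length new) _ _ ⟨
        k₁ + 2 * length new + s * (k₁ + 2 * length new) + L * sum (map (λ j → ∣ P j ∣) lost) ∎
    }
    where
    open Progress pr
    open ≤-Reasoning
    grow : ∀ {S} → Treated s 𝒮 S → Treated (suc s) [] S
    grow (inj₁ lt)       = inj₁ (m≤n⇒m≤1+n lt)
    grow (inj₂ (eq , _)) = inj₁ (≤-reflexive (cong suc eq))
    shrink : ∀ j → ∣ P j ∣ < suc s → Treated s 𝒮 (P j)
    shrink j (s≤s ≤s) with m≤n⇒m<n∨m≡n ≤s
    ... | inj₁ lt = inj₁ lt
    ... | inj₂ eq = inj₂ (eq , P∈𝒮 j)

  rounds : Unique 𝒮 → (∀ j → P j List.∈ 𝒮) → ∀ k →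
    let s , out , tb = repeat (greedyRound (Vec.fromList 𝒮)) k (q , collect tb₀ , tb₀)
    in s ≡ k + q × Progress s [] out tb
  rounds unique P∈𝒮 zero    = refl , start
  rounds unique P∈𝒮 (suc k) with repeat (greedyRound (Vec.fromList 𝒮)) k (q , collect tb₀ , tb₀)
                              | rounds unique P∈𝒮 k
  ... | s , st | refl , pr rewrite foldVec-fromList (greedyStep s) st 𝒮 =
    refl , next-size (≤-trans (s≤s z≤n) (m≤n+m q k)) P∈𝒮 (round (m≤n+m q k) 𝒮 unique (λ S∈ → S∈) pr)

-- Comparison with the hidden partition

length-filter-split : {A : Set} {Q : A → Set} (Q? : ∀ x → Dec (Q x)) (xs : List A) →
  length (filter Q? xs) + length (filter (¬? ∘ Q?) xs) ≡ length xs
length-filter-split Q? []       = refl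
length-filter-split Q? (x ∷ xs) with does (Q? x)
... | true  = cong suc (length-filter-split Q? xs)
... | false = trans (+-suc _ _) (cong suc (length-filter-split Q? xs))

module Counting (d : ℕ) (L : ℕ) (L≡2d : L ≡ d + d) {u : ℕ} (𝒮 : List (Subset u)) (unique : Unique 𝒮)
                {m : ℕ} (P : Fin m → Subset u) (P∈𝒮 : ∀ j → P j List.∈ 𝒮)
                (nonempty : ∀ j → Nonempty (P j))
                (disjoint : ∀ {i j x} → x ∈ P i → x ∈ P j → i ≡ j) where
  private q = suc L
  open Auction L 𝒮 using (prices; finally; module Duality)
  open Duality P P∈𝒮 nonempty disjoint prices (finally unique) using (P-injective; small-bound)
  open Greedy L 𝒮 prices (finally unique) P disjoint public
  open Algorithm q L

  packing : List (Subset u × Subset u)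
  packing = greedy (Vec.fromList 𝒮) prices

  progress : ∃ λ tb → Progress (u + q) [] packing tb
  progress with repeat (greedyRound (Vec.fromList 𝒮)) u (q , collect prices , prices) | rounds unique P∈𝒮 u
  ... | s , out , tb | refl , pr = tb , pr

  -- Multiplied by L, the small sets of the partition account for k₁ (L + 1), the large served ones
  -- for L h and the lost ones for k₁ + 2h, where h is the number of new sets: together (L + 2)(k₁ +
  -- h). The choice L = 2d turns L / (L + 2) into d / (d + 1).
  enough : d * m ≤ suc d * length packing
  enough with progress
  ... | tb , pr = *-cancelˡ-≤ 2 (begin
    2 * (d * m)
      ≡⟨ doubled d m ⟩
    (d + d) * m
      ≡⟨ cong₂ _*_ (sym L≡2d) (sym #js) ⟩
    L * (length small + length large)
      ≤⟨ *-monoʳ-≤ L (+-monoʳ-≤ (length small) large-bound) ⟩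
    L * (length small + (length new + length lost))
      ≡⟨ expand L (length small) (length new) (length lost) ⟩
    length small * L + (L * length new + L * length lost)
      ≤⟨ +-mono-≤ (small-bound (Unique.filter⁺ small? (Unique.allFin⁺ m)) (all-filter small? (allFin m)))
                  (+-monoʳ-≤ (L * length new) (lost-bound (≤-trans (s≤s z≤n) (m≤n+m q u)))) ⟩
    k₁ * q + (L * length new + (k₁ + 2 * length new))
      ≡⟨ collected L k₁ (length new) ⟩
    (L + 2) * (length new + k₁)
      ≡⟨ cong₂ (λ l n → (l + 2) * n) L≡2d (sym #packing) ⟩
    (d + d + 2) * length packing
      ≡⟨ halve d (length packing) ⟩
    2 * (suc d * length packing) ∎)
    where
    open ≤-Reasoning
    open Progress pr

    small? : ∀ j → Dec (∣ P j ∣ < q)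
    small? j = ∣ P j ∣ <? q

    small large : List (Fin m)
    small = filter small? (allFin m)
    large = filter (¬? ∘ small?) (allFin m)

    #js : length small + length large ≡ m
    #js = trans (length-filter-split small? (allFin m)) (length-tabulate (λ i → i))

    #packing : length packing ≡ length new + k₁
    #packing = trans (cong length out≡) (length-++ new)

    found : ∀ {T} → T List.∈ map P large → T List.∈ map proj₁ new ++ map P lost
    found T∈ with ∈-map⁻ P T∈
    ... | j , j∈ , refl with complete j (≮⇒≥ (proj₂ (∈-filter⁻ (¬? ∘ small?) {xs = allFin m} j∈)))
                                       (inj₁ (≤-<-trans (∣p∣≤n (P j)) (m<m+n u (s≤s z≤n))))
    ... | inj₁ P∈ = ∈-++⁺ˡ P∈
    ... | inj₂ l∈ = ∈-++⁺ʳ (map proj₁ new) (∈-map⁺ P l∈)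

    large-bound : length large ≤ length new + length lost
    large-bound = begin
      length large                               ≡⟨ length-map P large ⟨
      length (map P large)
        ≤⟨ length-⊆ (Unique.map⁺ P-injective (Unique.filter⁺ (¬? ∘ small?) (Unique.allFin⁺ m))) found ⟩
      length (map proj₁ new ++ map P lost)       ≡⟨ length-++ (map proj₁ new) ⟩
      length (map proj₁ new) + length (map P lost) ≡⟨ cong₂ _+_ (length-map proj₁ new) (length-map P lost) ⟩
      length new + length lost                   ∎

    doubled : ∀ d m → 2 * (d * m) ≡ (d + d) * m
    doubled = solve-∀
    expand : ∀ L a h g → L * (a + (h + g)) ≡ a * L + (L * h + L * g)
    expand = solve-∀
    collected : ∀ L k h → k * suc L + (L * h + (k + 2 * h)) ≡ (L + 2) * (h + k)
    collected = solve-∀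
    halve : ∀ d k → (d + d + 2) * k ≡ 2 * (suc d * k)
    halve = solve-∀

-- Cutting the packing down to the required number

module Trimming {Z : Set} (R : Z → Z → Set) (symmetric : ∀ {x y} → R x y → R y x) (Q : Z → Set)
                (d N K : ℕ) (N≤dK : N ≤ d * K) where

  -- Here j counts the remaining rounds. As long as b is positive no subtraction has been truncated,
  -- so `unpaid` is an equality; it yields `minimal` and shows that `rest` cannot run out before the
  -- budget does.
  record Trim (j b : ℕ) (rest res : List Z) : Set where
    field
      fuel     : b ≤ d * j
      lengths  : length rest + length res ≡ K
      paid     : N ≤ d * length res + b
      unpaid   : b ≢ 0 → N ≡ d * length res + b
      minimal  : length res ≡ 0 ⊎ d * pred (length res) < N
      rest-Q   : All Q rest
      res-Q    : All Q res
      rest-R   : AllPairs R rest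
      res-R    : AllPairs R res
      cross-R  : All (λ x → All (R x) res) rest

  TrimState : ℕ → ℕ × List Z × List Z → Set
  TrimState j (b , rest , res) = Trim j b rest res

  trim-step : ∀ {j} st → TrimState (suc j) st → TrimState j (trim d st)
  trim-step {j} (zero , rest , res) t = record { Trim t hiding (fuel) ; fuel = z≤n }
  trim-step (suc b , [] , res) t = contradiction N≤dK (<⇒≱ (begin-strict
    d * K                         ≡⟨ cong (d *_) lengths ⟨
    d * length res                <⟨ m<m+n (d * length res) (s≤s z≤n) ⟩
    d * length res + suc b        ≡⟨ unpaid (λ ()) ⟨
    N                             ∎))
    where
    open Trim t using (lengths; unpaid)
    open ≤-Reasoning
  trim-step {j} (suc b , p ∷ rest , res) t with rest-Q | rest-R | cross-R
    where open Trim t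
  ... | Qp ∷ Qrest | Rp ∷ Rrest | Cp ∷ Crest = record
    { fuel    = ≤-trans (∸-monoˡ-≤ d fuel) (≤-reflexive (trans (cong (_∸ d) (*-suc d j)) (m+n∸m≡n d (d * j))))
    ; lengths = trans (+-suc (length rest) (length res)) lengths
    ; paid    = begin
        N                                          ≤⟨ paid ⟩
        d * length res + suc b                     ≤⟨ +-monoʳ-≤ (d * length res) (m≤n+m∸n (suc b) d) ⟩
        d * length res + (d + (suc b ∸ d))         ≡⟨ regroup (d * length res) d _ ⟩
        d + d * length res + (suc b ∸ d)           ≡⟨ cong (_+ (suc b ∸ d)) (*-suc d (length res)) ⟨
        d * suc (length res) + (suc b ∸ d)         ∎
    ; unpaid  = λ left → begin-equality
        N                                          ≡⟨ unpaid (λ ()) ⟩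
        d * length res + suc b                     ≡⟨ cong (d * length res +_) (m+[n∸m]≡n {d} (<⇒≤ (m∸n≢0⇒n<m left))) ⟨
        d * length res + (d + (suc b ∸ d))         ≡⟨ regroup (d * length res) d _ ⟩
        d + d * length res + (suc b ∸ d)           ≡⟨ cong (_+ (suc b ∸ d)) (*-suc d (length res)) ⟨
        d * suc (length res) + (suc b ∸ d)         ∎
    ; minimal = inj₂ (begin-strict
        d * length res          <⟨ m<m+n (d * length res) (s≤s z≤n) ⟩
        d * length res + suc b  ≡⟨ unpaid (λ ()) ⟨
        N                       ∎)
    ; rest-Q  = Qrest
    ; res-Q   = Qp ∷ res-Q
    ; rest-R  = Rrest
    ; res-R   = Cp ∷ res-R
    ; cross-R = All.zipWith (λ { (r , c) → symmetric r ∷ c }) (Rp , Crest)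
    }
    where
    open Trim t
    open ≤-Reasoning
    regroup : ∀ a b c → a + (b + c) ≡ b + a + c
    regroup = solve-∀

  trimmed : ∀ k {j} st → TrimState (k + j) st → TrimState j (repeat (trim d) k st)
  trimmed zero    st t = t
  trimmed (suc k) {j} st t = trim-step _ (trimmed k st (subst (λ i → TrimState i st) (sym (+-suc k j)) t))

  record Trimmed (res : List Z) : Set where
    field
      sufficient : N ≤ d * length res
      least      : ∀ k → N ≤ d * k → length res ≤ k
      all        : All Q res
      pairs      : AllPairs R res

  trimmed-result : ∀ k (zs : List Z) → length zs ≡ K → N ≤ d * k → All Q zs → AllPairs R zs →
    Trimmed (proj₂ (proj₂ (repeat (trim d) k (N , zs , []))))
  trimmed-result k zs #zs N≤dk Qzs Rzs = record
    { sufficient = ≤-trans paid (≤-reflexive (trans (cong (d * length (proj₂ (proj₂ final)) +_) b≡0) (+-identityʳ _)))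
    ; least      = λ i N≤di →
        [ (λ e → ≤-trans (≤-reflexive e) z≤n) , (λ lt → bound i _ (<-≤-trans lt N≤di)) ]′ minimal
    ; all        = res-Q
    ; pairs      = res-R
    }
    where
    final : ℕ × List Z × List Z
    final = repeat (trim d) k (N , zs , [])

    initial : TrimState (k + 0) (N , zs , [])
    initial = record
      { fuel    = subst (λ i → N ≤ d * i) (sym (+-identityʳ k)) N≤dk
      ; lengths = trans (+-identityʳ _) #zs
      ; paid    = ≤-reflexive (sym (cong (_+ N) (*-zeroʳ d)))
      ; unpaid  = λ _ → sym (cong (_+ N) (*-zeroʳ d))
      ; minimal = inj₁ refl
      ; rest-Q  = Qzs
      ; res-Q   = []
      ; rest-R  = Rzs
      ; res-R   = []
      ; cross-R = All.universal (λ _ → []) zs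
      }

    trimmed-final : TrimState 0 final
    trimmed-final = trimmed k (N , zs , []) initial

    open Trim trimmed-final

    b≡0 : proj₁ final ≡ 0
    b≡0 = n≤0⇒n≡0 (≤-trans fuel (≤-reflexive (*-zeroʳ d)))
    bound : ∀ i r → d * pred r < d * i → r ≤ i
    bound i zero    lt = z≤n
    bound i (suc r) lt = *-cancelˡ-< d r i lt

-- Rational inequalities with cleared denominators

toℚᵘ-fromℕ : ∀ n → ℚ.toℚᵘ (fromℕ n) ℚᵘ.≃ mkℚᵘ (pos n) 0
toℚᵘ-fromℕ n = ℚ.toℚᵘ-fromℚᵘ (mkℚᵘ (pos n) 0)

+-cancelʳ-≤ℤ : ∀ j {i k} → i ℤ.+ j ℤ.≤ k ℤ.+ j → i ℤ.≤ k
+-cancelʳ-≤ℤ j {i} {k} le = subst₂ ℤ._≤_ (ring i j) (ring k j) (ℤ.+-monoˡ-≤ (ℤ.- j) le)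
  where
  ring : ∀ i j → i ℤ.+ j ℤ.+ (ℤ.- j) ≡ i
  ring = ℤ.solve-∀

module _ (p d-1 : ℕ) .(c : Coprime p (suc d-1)) (m k : ℕ) where
  private
    d = suc d-1

    δ : ℚ
    δ = mkℚ (pos p) d-1 c

    remainder : ℚᵘ
    remainder = (1ℚᵘ ℚᵘ.+ mkℚᵘ (ℤ.- pos p) d-1) ℚᵘ.* mkℚᵘ (pos m) 0

    remainder-≃ : ℚ.toℚᵘ ((1ℚ ℚ.- δ) ℚ.* fromℕ m) ℚᵘ.≃ remainder
    remainder-≃ = ℚᵘ.≃-trans (ℚ.toℚᵘ-homo-* (1ℚ ℚ.- δ) (fromℕ m))
      (ℚᵘ.*-cong (ℚᵘ.≃-trans (ℚ.toℚᵘ-homo-+ 1ℚ (ℚ.- δ)) (ℚᵘ.+-congʳ 1ℚᵘ (ℚ.toℚᵘ-homo‿- δ)))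
                 (toℚᵘ-fromℕ m))

    numerator : ℚᵘ.↥ remainder ℤ.* pos 1 ℤ.+ pos (p * m) ≡ pos (d * m)
    numerator = begin
      ℚᵘ.↥ remainder ℤ.* pos 1 ℤ.+ pos (p * m)
        ≡⟨ cong (ℤ._+_ (ℚᵘ.↥ remainder ℤ.* pos 1)) (ℤ.pos-* p m) ⟩
      ℚᵘ.↥ remainder ℤ.* pos 1 ℤ.+ pos p ℤ.* pos m
        ≡⟨ ring (pos d) (pos p) (pos m) ⟩
      pos d ℤ.* pos m
        ≡⟨ ℤ.pos-* d m ⟨
      pos (d * m) ∎
      where
      open ≡-Reasoning
      ring : ∀ d p m → (pos 1 ℤ.* d ℤ.+ (ℤ.- p) ℤ.* pos 1) ℤ.* m ℤ.* pos 1 ℤ.+ p ℤ.* m ≡ d ℤ.* m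
      ring = ℤ.solve-∀

    denominator : pos k ℤ.* ℚᵘ.↧ remainder ℤ.+ pos (p * m) ≡ pos (d * k + p * m)
    denominator = begin
      pos k ℤ.* ℚᵘ.↧ remainder ℤ.+ pos (p * m)
        ≡⟨ cong (λ n → pos k ℤ.* pos (suc n) ℤ.+ pos (p * m)) (trans (*-identityʳ _) (+-identityʳ d-1)) ⟩
      pos k ℤ.* pos d ℤ.+ pos (p * m)
        ≡⟨ cong (ℤ._+ pos (p * m)) (trans (sym (ℤ.pos-* k d)) (cong pos (*-comm k d))) ⟩
      pos (d * k) ℤ.+ pos (p * m)
        ≡⟨ ℤ.pos-+ (d * k) (p * m) ⟨
      pos (d * k + p * m) ∎
      where open ≡-Reasoning

  -- Adding p m to both sides of (d - p) m ≤ d k keeps everything in ℕ, although d - p may be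
  -- negative.
  [1-δ]m≤k⁺ : d * m ≤ d * k + p * m → (1ℚ ℚ.- δ) ℚ.* fromℕ m ℚ.≤ fromℕ k
  [1-δ]m≤k⁺ le = ℚ.toℚᵘ-cancel-≤ (ℚᵘ.≤-respˡ-≃ (ℚᵘ.≃-sym remainder-≃)
    (ℚᵘ.≤-respʳ-≃ (ℚᵘ.≃-sym (toℚᵘ-fromℕ k))
    (ℚᵘ.*≤* (+-cancelʳ-≤ℤ (pos (p * m)) (subst₂ ℤ._≤_ (sym numerator) (sym denominator) (ℤ.+≤+ le))))))

  [1-δ]m≤k⁻ : (1ℚ ℚ.- δ) ℚ.* fromℕ m ℚ.≤ fromℕ k → d * m ≤ d * k + p * m
  [1-δ]m≤k⁻ le = ℤ.drop‿+≤+ (subst₂ ℤ._≤_ numerator denominator (ℤ.+-monoˡ-≤ (pos (p * m))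
    (ℚᵘ.drop-*≤* (ℚᵘ.≤-respˡ-≃ remainder-≃ (ℚᵘ.≤-respʳ-≃ (toℚᵘ-fromℕ k) (ℚ.toℚᵘ-mono-≤ le))))))

1/ : ℕ → ℚ
1/ q-1 = pos 1 ℚ./ suc q-1

0<1/ : ∀ q-1 → 0ℚ ℚ.< 1/ q-1
0<1/ q-1 = ℚ.toℚᵘ-cancel-<
  (ℚᵘ.<-respʳ-≃ (ℚᵘ.≃-sym (ℚ.toℚᵘ-fromℚᵘ (mkℚᵘ (pos 1) q-1))) (ℚᵘ.*<* (ℤ.+<+ (s≤s z≤n))))

1/-≤ : ∀ q-1 {s a} → s ≤ suc q-1 * a → 1/ q-1 ℚ.* fromℕ s ℚ.≤ fromℕ a
1/-≤ q-1 {s} {a} le = ℚ.toℚᵘ-cancel-≤ (ℚᵘ.≤-respˡ-≃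
  (ℚᵘ.≃-sym (ℚᵘ.≃-trans (ℚ.toℚᵘ-homo-* (1/ q-1) (fromℕ s))
    (ℚᵘ.*-cong (ℚ.toℚᵘ-fromℚᵘ (mkℚᵘ (pos 1) q-1)) (toℚᵘ-fromℕ s))))
  (ℚᵘ.≤-respʳ-≃ (ℚᵘ.≃-sym (toℚᵘ-fromℕ a)) (ℚᵘ.*≤* (subst₂ ℤ._≤_ (sym lhs) (sym rhs) (ℤ.+≤+ le)))))
  where
  lhs : pos 1 ℤ.* pos s ℤ.* pos 1 ≡ pos s
  lhs = trans (ℤ.*-identityʳ _) (ℤ.*-identityˡ _)
  rhs : pos a ℤ.* pos (suc (q-1 * 1)) ≡ pos (suc q-1 * a)
  rhs = trans (cong (λ n → pos a ℤ.* pos (suc n)) (*-identityʳ q-1))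
    (trans (sym (ℤ.pos-* a (suc q-1))) (cong pos (*-comm a (suc q-1))))

-- Correctness of the output

AllPairs-lookup : {A : Set} {R : A → A → Set} → (∀ {x y} → R x y → R y x) →
  ∀ {xs} → AllPairs R xs → ∀ i j → i ≢ j → R (List.lookup xs i) (List.lookup xs j)
AllPairs-lookup symm (r ∷ rs) zero    zero    i≢j = contradiction refl i≢j
AllPairs-lookup symm (r ∷ rs) zero    (suc j) i≢j = All.lookup r (∈-lookup j)
AllPairs-lookup symm (r ∷ rs) (suc i) zero    i≢j = symm (All.lookup r (∈-lookup i))
AllPairs-lookup symm (r ∷ rs) (suc i) (suc j) i≢j = AllPairs-lookup symm rs i j (i≢j ∘ cong suc)

encodeList-lookup : {A : Set} (f : A → Tree) (xs : List A) →
  encodeList (f ∘ List.lookup xs) (allFin (length xs)) ≡ encodeList f xs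
encodeList-lookup f xs = trans (go (List.lookup xs) (allFin _)) 
  (cong (encodeList f) (trans (map-tabulate (λ i → i) _) (tabulate-lookup xs)))
  where
  go : ∀ {n} (g : Fin n → _) is → encodeList (f ∘ g) is ≡ encodeList f (map g is)
  go g []       = refl
  go g (i ∷ is) = cong (f (g i) ∙_) (go g is)

module Solution (p d-1 : ℕ) .(c : Coprime p (suc d-1)) (0<p : 1 ≤ p) where
  d L a : ℕ
  d = suc d-1
  L = d + d
  a = d ∸ p

  δ ε : ℚ
  δ = mkℚ (pos p) d-1 c
  -- `1/` takes the predecessor of the denominator, so this is 1 / (L + 1) = 1 / q.
  ε = 1/ L

  open Packing (suc L) L a d
  open PackingT (suc L) L a d using (packT) public

  module _ (I : Instance) (promise : HasPartition I) where
    open Instance I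

    P : Fin m → Subset u
    P = proj₁ promise

    open IsPartition (proj₂ (proj₂ promise)) using (nonempty) renaming (disjoint to pairwise)

    disjoint : ∀ {i j x} → x ∈ P i → x ∈ P j → i ≡ j
    disjoint {i} {j} x∈i x∈j with i Fin.≟ j
    ... | yes i≡j = i≡j
    ... | no i≢j  = contradiction (_ , x∈p∩q⁺ (x∈i , x∈j)) (pairwise i j i≢j)

    open Counting d L refl 𝒮 distinct P (proj₁ (proj₂ promise)) nonempty disjoint

    symmetric : ∀ {x y} → Compatible x y → Compatible y x
    symmetric (S≢T , A∩B=∅) = S≢T ∘ sym , λ x x∈B x∈A → A∩B=∅ x x∈A x∈B

    -- As p ≥ 1, the number a is at most d - 1, and (d - 1)(d + 1) ≤ d² absorbs the factor (d + 1) /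
    -- d lost in `enough`.
    affordable : m * a ≤ d * length packing
    affordable = *-cancelˡ-≤ d (begin
      d * (m * a)                      ≤⟨ *-monoʳ-≤ d (*-monoʳ-≤ m (∸-monoʳ-≤ d 0<p)) ⟩
      d * (m * d-1)                    ≡⟨ left d m d-1 ⟩
      d-1 * (d * m)                    ≤⟨ *-monoʳ-≤ d-1 enough ⟩
      d-1 * (suc d * length packing)   ≤⟨ m≤m+n _ (length packing) ⟩
      d-1 * (suc d * length packing) + length packing  ≡⟨ right d-1 (length packing) ⟩
      d * (d * length packing)         ∎)
      where
      open ≤-Reasoning
      left : ∀ d m e → d * (m * e) ≡ e * (d * m)
      left = solve-∀
      right : ∀ e k → e * (suc (suc e) * k) + k ≡ suc e * (suc e * k)
      right = solve-∀

    budget : ∀ k → repeat (a +_) k 0 ≡ k * a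
    budget zero    = refl
    budget (suc k) = cong (a +_) (budget k)

    output : List (Subset u × Subset u)
    output = pack (Vec.fromList 𝒮) m

    open Trimming Compatible symmetric Valid d (m * a) (length packing) affordable

    trimmed-output : Trimmed output
    trimmed-output = subst (λ b → Trimmed (proj₂ (proj₂ (repeat (trim d) m (b , packing , [])))))
      (sym (budget m))
      (trimmed-result m packing refl (≤-trans (*-monoʳ-≤ m (m∸n≤m d p)) (≤-reflexive (*-comm m d)))
        (Progress.valid (proj₂ progress)) (Progress.compatible (proj₂ progress)))

    open Trimmed trimmed-output

    m*a≡ : m * a ≡ d * m ∸ p * m
    m*a≡ = trans (*-comm m a) (*-distribʳ-∸ m d p)

    partialPacking : PartialPacking δ ε I
    partialPacking = record
      { m′         = length output
      ; m′-def     = [1-δ]m≤k⁺ p d-1 c m (length output)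
                       (≤-trans (m≤n+m∸n (d * m) (p * m))
                         (≤-trans (≤-reflexive (+-comm (p * m) _))
                           (+-monoˡ-≤ (p * m) (subst (_≤ d * length output) m*a≡ sufficient)))) ,
                     λ k le → least k (subst (_≤ d * k) (sym m*a≡)
                       (m≤n+o⇒m∸n≤o (d * m) (p * m)
                         (≤-trans ([1-δ]m≤k⁻ p d-1 c m k le) (≤-reflexive (+-comm (d * k) _)))))
      ; S          = proj₁ ∘ List.lookup output
      ; A          = proj₂ ∘ List.lookup output
      ; S∈𝒮        = λ i → proj₁ (valid i)
      ; S-distinct = λ i j i≢j → proj₁ (AllPairs-lookup symmetric pairs i j i≢j)
      ; A⊆S        = λ i → proj₁ (proj₂ (valid i))
      ; A-large    = λ i → 1/-≤ L {∣ proj₁ (List.lookup output i) ∣} {∣ proj₂ (List.lookup output i) ∣}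
                       (proj₂ (proj₂ (valid i)))
      ; A-disjoint = λ i j i≢j (x , x∈) →
          let x∈A , x∈B = x∈p∩q⁻ _ _ x∈ in proj₂ (AllPairs-lookup symmetric pairs i j i≢j) x x∈A x∈B
      }
      where
      valid : ∀ i → Valid (List.lookup output i)
      valid i = All.lookup all (∈-lookup i)

    correct : IsPartialPacking δ ε I (enc (list (sub ⊗ sub)) {dims I} output)
    correct = partialPacking , 
      sym (encodeList-lookup (λ e → encodeSubset (proj₁ e) ∙ encodeSubset (proj₂ e)) output)

theorem3 : (δ : ℚ) → 0ℚ ℚ.< δ →
    Σ ℚ λ ε → 0ℚ ℚ.< ε ×
    Σ Program λ 𝒜 →
    SolvesInRandomizedPolyTime 𝒜 encodeInstance HasPartition (IsPartialPacking δ ε)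
theorem3 (mkℚ (pos zero) d-1 c)    (ℚ.*<* (ℤ.+<+ ()))
theorem3 (mkℚ +[1+ p ] d-1 c)    _ =
  ε , 0<1/ L , program packT , deterministic packT correct
  where open Solution (suc p) d-1 c (s≤s z≤n)
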